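{- For every $\alpha\ge 1$, the runtime of LOHification of rank $\alpha$ is in $$\Omega\left(n\log\left(\frac{n}{n\cdot(\alpha-1)+1}\right)+\frac{n\cdot\alpha\cdot\log(\alpha)}{\alpha-1}\right),$$ where for $\alpha=1$ the expression is interpreted as its limit as $\alpha\to 1$ (so that the second term is $n$).
   Context: Layer-ordered heap (LOH) of rank $\alpha\ge 1$ on $n$ elements: a partition of an array of $n$ mutually comparable (distinct) values into consecutive layers $L_0\le L_1\le\cdots\le L_{\ell-1}$ (every element of $L_i$ is $\le$ every element of $L_{i+1}$), each layer being internally unordered. With pivots $p_i=\left\lceil\sum_{j=0}^{i}\alpha^j\right\rceil$, the layer sizes are $|L_0|=p_0=1$, $|L_i|=p_i-p_{i-1}$, and the last layer contains the remaining elements beyond the last pivot that is at most $n$. LOHification of rank $\alpha$ is the problem of rearranging an arbitrary array of length $n$ into a LOH of rank $\alpha$. Rank $\alpha=1$ is comparison sorting. The lower bound is for the worst-case runtime of any comparison-based algorithm (decision-tree model), asymptotically as $n\to\infty$. -}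

module Defs where

open import Data.Bool.Base using (if_then_else_)
open import Data.Fin.Base using (Fin; toℕ)
open import Data.Fin.Permutation using (Permutation′; _⟨$⟩ʳ_)
import Data.Integer.Base as ℤ
open import Data.Nat.Base as ℕ using (ℕ; zero; suc)
import Data.Nat.Properties as ℕₚ
open import Data.Product.Base using (∃-syntax; _×_; _,_)
open import Data.Rational.Base as ℚ using (ℚ; 0ℚ; 1ℚ; ½; ∣_∣)
import Data.Rational.Properties as ℚₚ
open import Data.Rational.Solver using (module +-*-Solver)
open import Data.Sum.Base using (_⊎_; inj₁; inj₂)
open import Data.Vec.Functional using (Vector)
open import Function.Definitions using (Injective)
open import Relation.Binary.PropositionalEquality
open import Relation.Nullary using (¬_; yes; no; does)
open import Relation.Nullary.Negation using (contradiction)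

private
  variable
    n : ℕ

  0<½ : 0ℚ ℚ.< ½
  0<½ = ℚₚ.positive⁻¹ ½

  *-pos : ∀ {p q} → 0ℚ ℚ.< p → 0ℚ ℚ.< q → 0ℚ ℚ.< p ℚ.* q
  *-pos {p} {q} 0<p 0<q =
    ℚₚ.positive⁻¹ (p ℚ.* q) {{ℚₚ.pos*pos⇒pos p {{ℚ.positive 0<p}} q {{ℚ.positive 0<q}}}}

  half : ∀ {ε} → 0ℚ ℚ.< ε → ∃[ δ ] 0ℚ ℚ.< δ × δ ℚ.+ δ ≡ ε
  half {ε} 0<ε = ½ ℚ.* ε , *-pos 0<½ 0<ε ,
    trans (sym (ℚₚ.*-distribʳ-+ ε ½ ½)) (ℚₚ.*-identityˡ ε)

  divide : ∀ {b ε} → 0ℚ ℚ.< b → 0ℚ ℚ.< ε → ∃[ δ ] 0ℚ ℚ.< δ × b ℚ.* δ ≡ ε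
  divide {b} {ε} 0<b 0<ε = 1/b ℚ.* ε , *-pos 0<1/b 0<ε ,
    trans (sym (ℚₚ.*-assoc b 1/b ε))
      (trans (cong (ℚ._* ε) (ℚₚ.*-inverseʳ b {{nz}})) (ℚₚ.*-identityˡ ε))
    where
      nz : ℚ.NonZero b
      nz = ℚ.>-nonZero 0<b
      1/b : ℚ
      1/b = (ℚ.1/ b) {{nz}}
      0<1/b : 0ℚ ℚ.< 1/b
      0<1/b = ℚₚ.positive⁻¹ 1/b {{ℚₚ.1/pos⇒pos b {{ℚ.positive 0<b}}}}

  ∣*∣-bound : ∀ a c {b δ} → 0ℚ ℚ.< b → ∣ a ∣ ℚ.≤ b → ∣ c ∣ ℚ.< δ →
              ∣ a ℚ.* c ∣ ℚ.< b ℚ.* δ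
  ∣*∣-bound a c {b} {δ} 0<b a≤b c<δ = begin-strict
    ∣ a ℚ.* c ∣        ≡⟨ ℚₚ.∣p*q∣≡∣p∣*∣q∣ a c ⟩
    ∣ a ∣ ℚ.* ∣ c ∣    ≤⟨ ℚₚ.*-monoʳ-≤-nonNeg ∣ c ∣ {{ℚₚ.∣-∣-nonNeg c}} a≤b ⟩
    b ℚ.* ∣ c ∣        <⟨ ℚₚ.*-monoʳ-<-pos b {{ℚ.positive 0<b}} c<δ ⟩
    b ℚ.* δ            ∎
    where open ℚₚ.≤-Reasoning

  -δ<q : ∀ q {δ} → ∣ q ∣ ℚ.< δ → ℚ.- δ ℚ.< q
  -δ<q q {δ} q<δ = subst (ℚ.- δ ℚ.<_) (neg-neg q)
    (ℚₚ.neg-antimono-< (ℚₚ.≤-<-trans -q≤∣q∣ q<δ))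
    where
      neg-neg : ∀ p → ℚ.- (ℚ.- p) ≡ p
      neg-neg = solve 1 (λ p → :- (:- p) := p) refl where open +-*-Solver
      p≤∣p∣ : ∀ p → p ℚ.≤ ∣ p ∣
      p≤∣p∣ p with ℚₚ.≤-total 0ℚ p
      ... | inj₁ 0≤p = ℚₚ.≤-reflexive (sym (ℚₚ.0≤p⇒∣p∣≡p 0≤p))
      ... | inj₂ p≤0 = ℚₚ.≤-trans p≤0 (ℚₚ.0≤∣p∣ p)
      -q≤∣q∣ : ℚ.- q ℚ.≤ ∣ q ∣
      -q≤∣q∣ = subst (ℚ.- q ℚ.≤_) (ℚₚ.∣-p∣≡∣p∣ q) (p≤∣p∣ (ℚ.- q))

IsCauchy : (ℕ → ℚ) → Set
IsCauchy x = ∀ ε → 0ℚ ℚ.< ε →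
  ∃[ N ] ∀ j k → N ℕ.≤ j → N ℕ.≤ k → ∣ x j ℚ.- x k ∣ ℚ.< ε

record ℝ : Set where
  constructor mkℝ
  field
    seq    : ℕ → ℚ
    cauchy : IsCauchy seq

open ℝ public

infix 4 _≈_ _<_ _≤_

-- Equality of real numbers is _≈_, not _≡_.
_≈_ : ℝ → ℝ → Set
x ≈ y = ∀ ε → 0ℚ ℚ.< ε → ∃[ N ] ∀ k → N ℕ.≤ k → ∣ seq x k ℚ.- seq y k ∣ ℚ.< ε

_<_ : ℝ → ℝ → Set
x < y = ∃[ ε ] 0ℚ ℚ.< ε × ∃[ N ] ∀ k → N ℕ.≤ k → seq x k ℚ.+ ε ℚ.≤ seq y k

_≤_ : ℝ → ℝ → Set
x ≤ y = ¬ (y < x)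

fromℚ : ℚ → ℝ
fromℚ q = mkℝ (λ _ → q) λ ε 0<ε → 0 , λ _ _ _ _ →
  subst (ℚ._< ε) (sym (cong ∣_∣ (ℚₚ.+-inverseʳ q))) 0<ε

fromℕ : ℕ → ℝ
fromℕ n = fromℚ (ℤ.+ n ℚ./ 1)

0ℝ 1ℝ : ℝ
0ℝ = fromℚ 0ℚ
1ℝ = fromℚ 1ℚ

infixl 6 _+_ _-_
infixl 7 _*_
infix  8 -_
infixr 8 _^_

_+_ : ℝ → ℝ → ℝ
x + y = mkℝ (λ k → seq x k ℚ.+ seq y k) +-cauchy
  where
    open ℚₚ.≤-Reasoning
    regroup : ∀ a b c d → (a ℚ.+ b) ℚ.- (c ℚ.+ d) ≡ (a ℚ.- c) ℚ.+ (b ℚ.- d)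
    regroup = solve 4 (λ a b c d → (a :+ b) :- (c :+ d) := (a :- c) :+ (b :- d)) refl
      where open +-*-Solver
    +-cauchy : IsCauchy (λ k → seq x k ℚ.+ seq y k)
    +-cauchy ε 0<ε with half 0<ε
    ... | δ , 0<δ , δ+δ≡ε with cauchy x δ 0<δ | cauchy y δ 0<δ
    ...   | M , xM | N , yN = M ℕ.⊔ N , λ j k j≥ k≥ → begin-strict
      ∣ (seq x j ℚ.+ seq y j) ℚ.- (seq x k ℚ.+ seq y k) ∣
        ≡⟨ cong ∣_∣ (regroup (seq x j) (seq y j) (seq x k) (seq y k)) ⟩
      ∣ (seq x j ℚ.- seq x k) ℚ.+ (seq y j ℚ.- seq y k) ∣
        ≤⟨ ℚₚ.∣p+q∣≤∣p∣+∣q∣ (seq x j ℚ.- seq x k) (seq y j ℚ.- seq y k) ⟩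
      ∣ seq x j ℚ.- seq x k ∣ ℚ.+ ∣ seq y j ℚ.- seq y k ∣
        <⟨ ℚₚ.+-mono-< (xM j k (ℕₚ.m⊔n≤o⇒m≤o M N j≥) (ℕₚ.m⊔n≤o⇒m≤o M N k≥))
                       (yN j k (ℕₚ.m⊔n≤o⇒n≤o M N j≥) (ℕₚ.m⊔n≤o⇒n≤o M N k≥)) ⟩
      δ ℚ.+ δ
        ≡⟨ δ+δ≡ε ⟩
      ε ∎

-_ : ℝ → ℝ
- x = mkℝ (λ k → ℚ.- seq x k) λ ε 0<ε → let N , xN = cauchy x ε 0<ε in
  N , λ j k j≥ k≥ → subst (ℚ._< ε) (sym (flip (seq x j) (seq x k))) (xN j k j≥ k≥)
  where
    flip : ∀ a b → ∣ ℚ.- a ℚ.- ℚ.- b ∣ ≡ ∣ a ℚ.- b ∣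
    flip a b = trans (cong ∣_∣ (sym (ℚₚ.neg-distrib-+ a (ℚ.- b)))) (ℚₚ.∣-p∣≡∣p∣ (a ℚ.- b))

_-_ : ℝ → ℝ → ℝ
x - y = x + (- y)

bounded : ∀ x → ∃[ b ] 0ℚ ℚ.< b × ∃[ N ] ∀ k → N ℕ.≤ k → ∣ seq x k ∣ ℚ.≤ b
bounded x with cauchy x 1ℚ (ℚₚ.positive⁻¹ 1ℚ)
... | N , xN = 1ℚ ℚ.+ ∣ seq x N ∣ ,
  ℚₚ.positive⁻¹ _ {{ℚₚ.pos+nonNeg⇒pos 1ℚ ∣ seq x N ∣ {{ℚₚ.∣-∣-nonNeg (seq x N)}}}} ,
  N , λ k k≥ → begin
    ∣ seq x k ∣
      ≡⟨ cong ∣_∣ (split (seq x k) (seq x N)) ⟩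
    ∣ (seq x k ℚ.- seq x N) ℚ.+ seq x N ∣
      ≤⟨ ℚₚ.∣p+q∣≤∣p∣+∣q∣ (seq x k ℚ.- seq x N) (seq x N) ⟩
    ∣ seq x k ℚ.- seq x N ∣ ℚ.+ ∣ seq x N ∣
      ≤⟨ ℚₚ.+-monoˡ-≤ ∣ seq x N ∣ (ℚₚ.<⇒≤ (xN k N k≥ ℕₚ.≤-refl)) ⟩
    1ℚ ℚ.+ ∣ seq x N ∣ ∎
  where
    open ℚₚ.≤-Reasoning
    split : ∀ a b → a ≡ (a ℚ.- b) ℚ.+ b
    split = solve 2 (λ a b → a := (a :- b) :+ b) refl where open +-*-Solver

private
  *-close : ∀ a b c d {B C δ δ′ ε} → 0ℚ ℚ.< B → 0ℚ ℚ.< C →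
            ∣ a ∣ ℚ.≤ B → ∣ d ∣ ℚ.≤ C → ∣ b ℚ.- d ∣ ℚ.< δ → ∣ a ℚ.- c ∣ ℚ.< δ′ →
            B ℚ.* δ ℚ.+ C ℚ.* δ′ ≡ ε → ∣ a ℚ.* b ℚ.- c ℚ.* d ∣ ℚ.< ε
  *-close a b c d {B} {C} {δ} {δ′} {ε} 0<B 0<C a≤B d≤C bd<δ ac<δ′ sum≡ε = begin-strict
    ∣ a ℚ.* b ℚ.- c ℚ.* d ∣
      ≡⟨ cong ∣_∣ (regroup a b c d) ⟩
    ∣ a ℚ.* (b ℚ.- d) ℚ.+ d ℚ.* (a ℚ.- c) ∣
      ≤⟨ ℚₚ.∣p+q∣≤∣p∣+∣q∣ (a ℚ.* (b ℚ.- d)) (d ℚ.* (a ℚ.- c)) ⟩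
    ∣ a ℚ.* (b ℚ.- d) ∣ ℚ.+ ∣ d ℚ.* (a ℚ.- c) ∣
      <⟨ ℚₚ.+-mono-< (∣*∣-bound a (b ℚ.- d) 0<B a≤B bd<δ)
                     (∣*∣-bound d (a ℚ.- c) 0<C d≤C ac<δ′) ⟩
    B ℚ.* δ ℚ.+ C ℚ.* δ′
      ≡⟨ sum≡ε ⟩
    ε ∎
    where
      open ℚₚ.≤-Reasoning
      regroup : ∀ a b c d → (a ℚ.* b) ℚ.- (c ℚ.* d) ≡ a ℚ.* (b ℚ.- d) ℚ.+ d ℚ.* (a ℚ.- c)
      regroup = solve 4 (λ a b c d →
        (a :* b) :- (c :* d) := a :* (b :- d) :+ d :* (a :- c)) refl
        where open +-*-Solver

_*_ : ℝ → ℝ → ℝ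
x * y = mkℝ (λ k → seq x k ℚ.* seq y k) *-cauchy
  where
    *-cauchy : IsCauchy (λ k → seq x k ℚ.* seq y k)
    *-cauchy ε 0<ε =
      let η , 0<η , η+η≡ε = half 0<ε
          b , 0<b , K , xK = bounded x
          c , 0<c , L , yL = bounded y
          δ , 0<δ , bδ≡η = divide 0<b 0<η
          δ′ , 0<δ′ , cδ′≡η = divide 0<c 0<η
          N , yN = cauchy y δ 0<δ
          M , xM = cauchy x δ′ 0<δ′
      in (K ℕ.⊔ L) ℕ.⊔ (M ℕ.⊔ N) , λ j k j≥ k≥ →
        let j≥KL = ℕₚ.m⊔n≤o⇒m≤o (K ℕ.⊔ L) (M ℕ.⊔ N) j≥
            j≥MN = ℕₚ.m⊔n≤o⇒n≤o (K ℕ.⊔ L) (M ℕ.⊔ N) j≥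
            k≥KL = ℕₚ.m⊔n≤o⇒m≤o (K ℕ.⊔ L) (M ℕ.⊔ N) k≥
            k≥MN = ℕₚ.m⊔n≤o⇒n≤o (K ℕ.⊔ L) (M ℕ.⊔ N) k≥
        in *-close (seq x j) (seq y j) (seq x k) (seq y k) 0<b 0<c
             (xK j (ℕₚ.m⊔n≤o⇒m≤o K L j≥KL))
             (yL k (ℕₚ.m⊔n≤o⇒n≤o K L k≥KL))
             (yN j k (ℕₚ.m⊔n≤o⇒n≤o M N j≥MN) (ℕₚ.m⊔n≤o⇒n≤o M N k≥MN))
             (xM j k (ℕₚ.m⊔n≤o⇒m≤o M N j≥MN) (ℕₚ.m⊔n≤o⇒m≤o M N k≥MN))
             (trans (cong₂ ℚ._+_ bδ≡η cδ′≡η) η+η≡ε)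

_^_ : ℝ → ℕ → ℝ
x ^ zero  = 1ℝ
x ^ suc j = x * x ^ j

-- sum f i = f 0 + … + f i
sum : (ℕ → ℝ) → ℕ → ℝ
sum f zero    = f zero
sum f (suc i) = sum f i + f (suc i)

-- Total on ℚ; the value at 0 is junk, and the entries of a positive real
-- are eventually nonzero.
recip : ℚ → ℚ
recip q with q ℚₚ.≟ 0ℚ
... | yes _   = 0ℚ
... | no  q≢0 = (ℚ.1/ q) {{ℚ.≢-nonZero q≢0}}

recip-inverse : ∀ {q} → 0ℚ ℚ.< q → q ℚ.* recip q ≡ 1ℚ
recip-inverse {q} 0<q with q ℚₚ.≟ 0ℚ
... | yes q≡0 = contradiction (sym q≡0) (ℚₚ.<⇒≢ 0<q)
... | no  q≢0 = ℚₚ.*-inverseʳ q {{ℚ.≢-nonZero q≢0}}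

private
  recip-pos : ∀ {q} → 0ℚ ℚ.< q → 0ℚ ℚ.< recip q
  recip-pos {q} 0<q = ℚₚ.*-cancelˡ-<-nonNeg q
    {{ℚ.nonNegative (ℚₚ.<⇒≤ 0<q)}}
    (subst₂ ℚ._<_ (sym (ℚₚ.*-zeroʳ q)) (sym (recip-inverse 0<q)) (ℚₚ.positive⁻¹ 1ℚ))

  recip-anti : ∀ {p q} → 0ℚ ℚ.< p → p ℚ.≤ q → recip q ℚ.≤ recip p
  recip-anti {p} {q} 0<p p≤q = begin
    recip q                        ≡⟨ sym (ℚₚ.*-identityˡ (recip q)) ⟩
    1ℚ ℚ.* recip q                 ≡⟨ cong (ℚ._* recip q) (sym (recip-inverse 0<p)) ⟩
    p ℚ.* recip p ℚ.* recip q      ≡⟨ ℚₚ.*-assoc p (recip p) (recip q) ⟩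
    p ℚ.* (recip p ℚ.* recip q)    ≤⟨ ℚₚ.*-monoʳ-≤-nonNeg (recip p ℚ.* recip q)
                                        {{ℚ.nonNegative (ℚₚ.<⇒≤ (*-pos (recip-pos 0<p) 0<rq))}} p≤q ⟩
    q ℚ.* (recip p ℚ.* recip q)    ≡⟨ shuffle q (recip p) (recip q) ⟩
    recip p ℚ.* (q ℚ.* recip q)    ≡⟨ cong (recip p ℚ.*_) (recip-inverse 0<q) ⟩
    recip p ℚ.* 1ℚ                 ≡⟨ ℚₚ.*-identityʳ (recip p) ⟩
    recip p                        ∎
    where
      open ℚₚ.≤-Reasoning
      0<q : 0ℚ ℚ.< q
      0<q = ℚₚ.<-≤-trans 0<p p≤q
      0<rq : 0ℚ ℚ.< recip q
      0<rq = recip-pos 0<q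
      shuffle : ∀ a b c → a ℚ.* (b ℚ.* c) ≡ b ℚ.* (a ℚ.* c)
      shuffle = solve 3 (λ a b c → a :* (b :* c) := b :* (a :* c)) refl
        where open +-*-Solver

private
  recip-difference : ∀ a b → 0ℚ ℚ.< a → 0ℚ ℚ.< b →
    recip a ℚ.- recip b ≡ (recip a ℚ.* recip b) ℚ.* (b ℚ.- a)
  recip-difference a b 0<a 0<b =
    trans (sym (cong₂ ℚ._-_ (ℚₚ.*-identityʳ (recip a)) (ℚₚ.*-identityʳ (recip b))))
      (trans (sym (cong₂ (λ s t → recip a ℚ.* s ℚ.- recip b ℚ.* t)
                     (recip-inverse 0<b) (recip-inverse 0<a)))
        (sym (expand a b (recip a) (recip b))))
    where
      expand : ∀ a b r s → (r ℚ.* s) ℚ.* (b ℚ.- a) ≡ r ℚ.* (b ℚ.* s) ℚ.- s ℚ.* (a ℚ.* r)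
      expand = solve 4 (λ a b r s →
        (r :* s) :* (b :- a) := r :* (b :* s) :- s :* (a :* r)) refl
        where open +-*-Solver

  recip-product≤ : ∀ β a b → 0ℚ ℚ.< β → β ℚ.≤ a → β ℚ.≤ b →
    ∣ recip a ℚ.* recip b ∣ ℚ.≤ recip β ℚ.* recip β
  recip-product≤ β a b 0<β β≤a β≤b = begin
    ∣ recip a ℚ.* recip b ∣
      ≡⟨ ℚₚ.0≤p⇒∣p∣≡p (ℚₚ.<⇒≤ (*-pos 0<ra 0<rb)) ⟩
    recip a ℚ.* recip b
      ≤⟨ ℚₚ.*-monoʳ-≤-nonNeg (recip b) {{ℚ.nonNegative (ℚₚ.<⇒≤ 0<rb)}} (recip-anti 0<β β≤a) ⟩
    recip β ℚ.* recip b
      ≤⟨ ℚₚ.*-monoˡ-≤-nonNeg (recip β) {{ℚ.nonNegative (ℚₚ.<⇒≤ (recip-pos 0<β))}} (recip-anti 0<β β≤b) ⟩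
    recip β ℚ.* recip β ∎
    where
      open ℚₚ.≤-Reasoning
      0<ra : 0ℚ ℚ.< recip a
      0<ra = recip-pos (ℚₚ.<-≤-trans 0<β β≤a)
      0<rb : 0ℚ ℚ.< recip b
      0<rb = recip-pos (ℚₚ.<-≤-trans 0<β β≤b)

  recip-close : ∀ β a b {δ ε} → 0ℚ ℚ.< β → β ℚ.≤ a → β ℚ.≤ b → ∣ b ℚ.- a ∣ ℚ.< δ →
    (recip β ℚ.* recip β) ℚ.* δ ≡ ε → ∣ recip a ℚ.- recip b ∣ ℚ.< ε
  recip-close β a b {δ} {ε} 0<β β≤a β≤b ba<δ Bδ≡ε =
    subst₂ ℚ._<_
      (cong ∣_∣ (sym (recip-difference a b (ℚₚ.<-≤-trans 0<β β≤a) (ℚₚ.<-≤-trans 0<β β≤b))))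
      Bδ≡ε
      (∣*∣-bound (recip a ℚ.* recip b) (b ℚ.- a)
        (*-pos (recip-pos 0<β) (recip-pos 0<β)) (recip-product≤ β a b 0<β β≤a β≤b) ba<δ)

inv : (y : ℝ) → 0ℝ < y → ℝ
inv y (β , 0<β , N , yN) = mkℝ (λ k → recip (seq y k)) inv-cauchy
  where
    β≤ : ∀ k → N ℕ.≤ k → β ℚ.≤ seq y k
    β≤ k k≥ = subst (ℚ._≤ seq y k) (ℚₚ.+-identityˡ β) (yN k k≥)
    inv-cauchy : IsCauchy (λ k → recip (seq y k))
    inv-cauchy ε 0<ε =
      let δ , 0<δ , Bδ≡ε = divide (*-pos (recip-pos 0<β) (recip-pos 0<β)) 0<ε
          M , yM = cauchy y δ 0<δ
      in N ℕ.⊔ M , λ j k j≥ k≥ →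
        recip-close β (seq y j) (seq y k) 0<β
          (β≤ j (ℕₚ.m⊔n≤o⇒m≤o N M j≥)) (β≤ k (ℕₚ.m⊔n≤o⇒m≤o N M k≥))
          (yM k j (ℕₚ.m⊔n≤o⇒n≤o N M k≥) (ℕₚ.m⊔n≤o⇒n≤o N M j≥)) Bδ≡ε

_÷_⟨_⟩ : ℝ → (y : ℝ) → 0ℝ < y → ℝ
x ÷ y ⟨ y>0 ⟩ = x * inv y y>0

_⟶_ : (ℕ → ℝ) → ℝ → Set
u ⟶ x = ∀ ε → 0ℚ ℚ.< ε → ∃[ N ] ∀ m → N ℕ.≤ m →
  (u m < x + fromℚ ε) × (x < u m + fromℚ ε)

-- y = ln x, i.e. x = exp y, where exp y is the limit of (1 + y/m)^m over
-- m = 1, 2, 3, …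
IsLn : ℝ → ℝ → Set
IsLn x y = (λ j → (1ℝ + y * fromℚ (ℤ.+ 1 ℚ./ suc j)) ^ suc j) ⟶ x

-- p = ⌈ x ⌉; given as a relation because ⌈_⌉ is not computable on ℝ
IsCeiling : ℝ → ℕ → Set
IsCeiling x p = (x ≤ fromℕ p) × (fromℕ p < x + 1ℝ)

_∈Ω_ : (ℕ → ℕ) → (ℕ → ℝ) → Set
T ∈Ω f = ∃[ c ] 0ℝ < c × ∃[ N ] ∀ n → N ℕ.≤ n → c * f n ≤ fromℕ (T n)

-- Classically the same as 1ℝ ≤ α, which does not decide between the two
-- cases by which the bound is defined.
_≥1 : ℝ → Set
α ≥1 = α ≈ 1ℝ ⊎ 1ℝ < α

IsPivots : ℝ → (ℕ → ℕ) → Set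
IsPivots α p = ∀ i → IsCeiling (sum (α ^_) i) (p i)

-- Position k lies in layer i.  Positions range over Fin n below, so the
-- layer after the last pivot ≤ n is cut off at n and takes the remainder,
-- and all later layers are empty.
InLayer : (p : ℕ → ℕ) → ℕ → ℕ → Set
InLayer p zero    k = k ℕ.< p 0
InLayer p (suc i) k = (p i ℕ.≤ k) × (k ℕ.< p (suc i))

IsLOH : ℝ → Vector ℕ n → Set
IsLOH α b = ∃[ p ] IsPivots α p ×
  (∀ i k k′ → InLayer p i (toℕ k) → InLayer p (suc i) (toℕ k′) → b k ℕ.≤ b k′)

-- A leaf carries the rearrangement to perform: position k of the output
-- receives the input at position π ⟨$⟩ʳ k.
data DecisionTree (n : ℕ) : Set where
  output  : Permutation′ n → DecisionTree n
  compare : (i j : Fin n) (if-less if-not-less : DecisionTree n) → DecisionTree n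

-- Comparisons see only the relative order of the input, and every relative
-- order of n distinct values occurs among values in ℕ.
Distinct : Vector ℕ n → Set
Distinct a = Injective _≡_ _≡_ a

result : DecisionTree n → Vector ℕ n → Permutation′ n
result (output π)        a = π
result (compare i j t u) a = if does (a i ℕₚ.<? a j) then result t a else result u a

comparisons : DecisionTree n → Vector ℕ n → ℕ
comparisons (output π)        a = 0
comparisons (compare i j t u) a =
  suc (if does (a i ℕₚ.<? a j) then comparisons t a else comparisons u a)

LOHifies : ℝ → DecisionTree n → Set
LOHifies α t = ∀ a → Distinct a → IsLOH α (λ k → a (result t a ⟨$⟩ʳ k))

IsWorstCase : DecisionTree n → ℕ → Set
IsWorstCase t w =
  (∀ a → Distinct a → comparisons t a ℕ.≤ w) ×
  (∃[ a ] Distinct a × comparisons t a ≡ w)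

denominator : ℝ → ℕ → ℝ
denominator α n = fromℕ n * (α - 1ℝ) + 1ℝ

private
  near-one : ∀ q a {δ} → 0ℚ ℚ.≤ q → ∣ a ℚ.- 1ℚ ∣ ℚ.< δ → (q ℚ.+ 1ℚ) ℚ.* δ ≡ ½ →
             0ℚ ℚ.+ ½ ℚ.≤ q ℚ.* (a ℚ.- 1ℚ) ℚ.+ 1ℚ
  near-one q a {δ} 0≤q a<δ bδ≡½ = ℚₚ.<⇒≤ (ℚₚ.+-monoˡ-< 1ℚ {ℚ.- ½} {q ℚ.* (a ℚ.- 1ℚ)}
    (-δ<q (q ℚ.* (a ℚ.- 1ℚ))
      (subst (∣ q ℚ.* (a ℚ.- 1ℚ) ∣ ℚ.<_) bδ≡½ (∣*∣-bound q (a ℚ.- 1ℚ) 0<b ∣q∣≤b a<δ))))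
    where
      q≤b : q ℚ.≤ q ℚ.+ 1ℚ
      q≤b = subst (ℚ._≤ q ℚ.+ 1ℚ) (ℚₚ.+-identityʳ q) (ℚₚ.+-monoʳ-≤ q (ℚₚ.nonNegative⁻¹ 1ℚ))
      0<b : 0ℚ ℚ.< q ℚ.+ 1ℚ
      0<b = ℚₚ.+-mono-≤-< 0≤q (ℚₚ.positive⁻¹ 1ℚ)
      ∣q∣≤b : ∣ q ∣ ℚ.≤ q ℚ.+ 1ℚ
      ∣q∣≤b = subst (ℚ._≤ q ℚ.+ 1ℚ) (sym (ℚₚ.0≤p⇒∣p∣≡p 0≤q)) q≤b

  minus-one : ∀ a ε → 1ℚ ℚ.+ ε ℚ.≤ a → 0ℚ ℚ.+ ε ℚ.≤ a ℚ.- 1ℚ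
  minus-one a ε 1+ε≤a = subst (ℚ._≤ a ℚ.- 1ℚ) cancel (ℚₚ.+-monoˡ-≤ (ℚ.- 1ℚ) 1+ε≤a)
    where
      cancel : (1ℚ ℚ.+ ε) ℚ.- 1ℚ ≡ 0ℚ ℚ.+ ε
      cancel = trans (cong (ℚ._- 1ℚ) (ℚₚ.+-comm 1ℚ ε))
        (trans (ℚₚ.+-assoc ε 1ℚ (ℚ.- 1ℚ)) (ℚₚ.+-comm ε 0ℚ))

  beyond-one : ∀ q a ε → 0ℚ ℚ.≤ q → 0ℚ ℚ.< ε → 1ℚ ℚ.+ ε ℚ.≤ a →
               0ℚ ℚ.+ 1ℚ ℚ.≤ q ℚ.* (a ℚ.- 1ℚ) ℚ.+ 1ℚ
  beyond-one q a ε 0≤q 0<ε 1+ε≤a = ℚₚ.+-monoˡ-≤ 1ℚ {0ℚ} {q ℚ.* (a ℚ.- 1ℚ)}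
    (subst (ℚ._≤ q ℚ.* (a ℚ.- 1ℚ)) (ℚₚ.*-zeroʳ q)
      (ℚₚ.*-monoˡ-≤-nonNeg q {{ℚ.nonNegative 0≤q}} {0ℚ} {a ℚ.- 1ℚ} 0≤a-1))
    where
      0≤a-1 : 0ℚ ℚ.≤ a ℚ.- 1ℚ
      0≤a-1 = ℚₚ.≤-trans (ℚₚ.<⇒≤ 0<ε)
        (subst (ℚ._≤ a ℚ.- 1ℚ) (ℚₚ.+-identityˡ ε) (minus-one a ε 1+ε≤a))

  0≤n : ∀ n → 0ℚ ℚ.≤ ℤ.+ n ℚ./ 1
  0≤n n = ℚₚ.nonNegative⁻¹ (ℤ.+ n ℚ./ 1) {{ℚₚ.normalize-nonNeg n 1}}

α-1>0 : ∀ {α} → 1ℝ < α → 0ℝ < α - 1ℝ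
α-1>0 {α} (ε , 0<ε , N , αN) = ε , 0<ε , N , λ k k≥ → minus-one (seq α k) ε (αN k k≥)

denominator>0 : ∀ {α} → α ≥1 → ∀ n → 0ℝ < denominator α n
denominator>0 {α} (inj₁ α≈1) n =
  let q = ℤ.+ n ℚ./ 1
      δ , 0<δ , bδ≡½ = divide (ℚₚ.+-mono-≤-< (0≤n n) (ℚₚ.positive⁻¹ 1ℚ)) 0<½
      N , αN = α≈1 δ 0<δ
  in ½ , 0<½ , N , λ k k≥ → near-one q (seq α k) (0≤n n) (αN k k≥) bδ≡½
denominator>0 {α} (inj₂ (ε , 0<ε , N , αN)) n =
  1ℚ , ℚₚ.positive⁻¹ 1ℚ , N , λ k k≥ →
    beyond-one (ℤ.+ n ℚ./ 1) (seq α k) ε (0≤n n) 0<ε (αN k k≥)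

-- s = n·α·ln α / (α - 1), replaced at α = 1 by its limit n
IsSecondTerm : (α : ℝ) → α ≥1 → ℕ → ℝ → Set
IsSecondTerm α (inj₁ α≈1) n s = s ≈ fromℕ n
IsSecondTerm α (inj₂ α>1) n s =
  ∃[ l ] IsLn α l × s ≈ (fromℕ n * α * l) ÷ (α - 1ℝ) ⟨ α-1>0 {α} α>1 ⟩

-- v = n·ln (n / (n·(α - 1) + 1)) + s
IsBound : (α : ℝ) → α ≥1 → ℕ → ℝ → Set
IsBound α α≥1 n v = ∃[ l ] ∃[ s ]
  IsLn (fromℕ n ÷ denominator α n ⟨ denominator>0 {α} α≥1 n ⟩) l ×
  IsSecondTerm α α≥1 n s ×
  v ≈ fromℕ n * l + s

module Submission where

-- For α > 1 the bound is linear in n: n / (n (α - 1) + 1) ≤ 1 / (α - 1), so both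
-- terms are at most a constant (depending on α) times n.  On the other side
-- every element takes part in a comparison, since the layers are nonempty and
-- an uncompared element could be turned into a new minimum or a new maximum;
-- hence n ≤ 2 T n.
--
-- For α = 1 all layers are singletons and the trees sort.  With m = ⌊ n /2⌋,
-- the m ^ m ways of inserting m elements into the gaps between m others lead
-- to different leaves, so m log₂ m ≤ T n, whereas the bound is at most
-- n (log₂ n + O(1)).
--
-- Logarithms are estimated through (1 + 1/m) ^ m ≥ 2, which gives
-- exp ℓ ≥ 2 ^ ℓ for natural ℓ.

open import Algebra.Bundles using (CommutativeRing)
import Algebra.Properties.Semiring.Exp as Exp
open import Data.Bool.Base using (true; false; if_then_else_)
open import Data.Empty using (⊥; ⊥-elim)
open import Data.Fin.Base as Fin using (Fin; toℕ; fromℕ<; combine; funToFin; finToFun; _↑ˡ_; _↑ʳ_; splitAt)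
open import Data.Fin.Permutation using (Permutation′; _⟨$⟩ʳ_; _⟨$⟩ˡ_; inverseˡ; inverseʳ)
import Data.Fin.Properties as Finₚ
import Data.Integer.Base as ℤ
import Data.Integer.Properties as ℤₚ
open import Data.List.Base using (List; []; _∷_; length)
open import Data.List.Membership.Propositional using (_∈_; _∉_)
open import Data.List.Membership.Setoid.Properties using (index-injective)
open import Data.List.Relation.Unary.Any using (here; there; index; any?)
open import Data.Nat.Base as ℕ using (ℕ; zero; suc; z≤n; s≤s; ⌊_/2⌋; ⌈_/2⌉)
import Data.Nat.Properties as ℕₚ
open import Data.Nat.Solver using () renaming (module +-*-Solver to ℕ-Solver)
open import Data.Product.Base using (∃-syntax; _×_; _,_; proj₁; proj₂)
open import Data.Rational.Base as ℚ using (ℚ; mkℚ; 0ℚ; 1ℚ; ½; ∣_∣)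
import Data.Rational.Properties as ℚₚ
open import Data.Rational.Solver using (module +-*-Solver)
open import Data.Rational.Unnormalised.Base as ℚᵘ using (mkℚᵘ)
import Data.Rational.Unnormalised.Properties as ℚᵘₚ
open import Data.Sum.Base using (inj₁; inj₂)
open import Data.Vec.Functional using (Vector; updateAt)
open import Data.Vec.Functional.Properties using (updateAt-updates; updateAt-minimal)
open import Function.Base using (const; _∘_)
open import Function.Definitions using (Injective)
open import Relation.Binary.Definitions using (tri<; tri≈; tri>)
open import Relation.Binary.PropositionalEquality
open import Relation.Nullary using (¬_; Dec; yes; no; does)
open import Relation.Nullary.Negation using (contradiction)
open import Defs

open Exp (CommutativeRing.semiring ℚₚ.+-*-commutativeRing)
  using () renaming (_^_ to _^ℚ_; ^-assocʳ to ^ℚ-assocʳ)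

-- Comparisons

private
  variable
    n : ℕ

comparands : DecisionTree n → Vector ℕ n → List (Fin n)
comparands (output π)        a = []
comparands (compare i j t u) a =
  i ∷ j ∷ (if does (a i ℕₚ.<? a j) then comparands t a else comparands u a)

length-comparands : ∀ (t : DecisionTree n) a →
  length (comparands t a) ≡ comparisons t a ℕ.* 2
length-comparands (output π) a = refl
length-comparands (compare i j t u) a with does (a i ℕₚ.<? a j)
... | true  = cong (suc ∘ suc) (length-comparands t a)
... | false = cong (suc ∘ suc) (length-comparands u a)

-- Entry `i` is never read on the path of `a`, so the changed input takes every branch in the same
-- way.
result-unchanged : ∀ (t : DecisionTree n) {a a′ i} → i ∉ comparands t a →
  (∀ k → k ≢ i → a′ k ≡ a k) → result t a′ ≡ result t a
result-unchanged (output π) i∉ agree = refl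
result-unchanged (compare j l t u) {a} i∉ agree
  rewrite agree j (λ j≡i → i∉ (here (sym j≡i)))
        | agree l (λ l≡i → i∉ (there (here (sym l≡i))))
  with does (a j ℕₚ.<? a l)
... | true  = result-unchanged t (λ i∈ → i∉ (there (there i∈))) agree
... | false = result-unchanged u (λ i∈ → i∉ (there (there i∈))) agree

-- Sending each index to the place of its occurrence in `xs` is injective.
covering-length : (xs : List (Fin n)) → (∀ i → i ∈ xs) → n ℕ.≤ length xs
covering-length xs cover = Finₚ.injective⇒≤ {f = index ∘ cover}
  (λ {i} {j} → index-injective (setoid _) (cover i) (cover j))

updateAt-distinct : ∀ {a : Vector ℕ n} → Distinct a → ∀ i v → (∀ k → a k ≢ v) →
  Distinct (updateAt a i (const v))
updateAt-distinct {a = a} dist i v fresh {k} {l} eq with k Finₚ.≟ i | l Finₚ.≟ i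
... | yes k≡i | yes l≡i = trans k≡i (sym l≡i)
... | yes refl | no l≢i = contradiction
  (trans (sym (updateAt-minimal l i a l≢i)) (trans (sym eq) (updateAt-updates i a))) (fresh l)
... | no k≢i | yes refl = contradiction
  (trans (sym (updateAt-minimal k i a k≢i)) (trans eq (updateAt-updates i a))) (fresh k)
... | no k≢i | no l≢i = dist
  (trans (sym (updateAt-minimal k i a k≢i)) (trans eq (updateAt-minimal l i a l≢i)))

-- Layers cut out by strictly increasing pivots

ProperPivots : (ℕ → ℕ) → Set
ProperPivots p = p 0 ≡ 1 × (∀ i → p i ℕ.< p (suc i))

module _ {p : ℕ → ℕ} (proper : ProperPivots p) where

  -- Strict growth from 1 carries the pivots past every position, so each position falls into some
  -- layer.
  pivot-lower : ∀ i → i ℕ.< p i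
  pivot-lower zero    = ℕₚ.≤-reflexive (sym (proj₁ proper))
  pivot-lower (suc i) = ℕₚ.≤-<-trans (pivot-lower i) (proj₂ proper i)

  layer-below : ∀ i k → k ℕ.< p i → ∃[ j ] InLayer p j k
  layer-below zero    k k<p = 0 , k<p
  layer-below (suc i) k k<p with k ℕₚ.<? p i
  ... | yes k<pᵢ = layer-below i k k<pᵢ
  ... | no  k≮pᵢ = suc i , ℕₚ.≮⇒≥ k≮pᵢ , k<p

  layer : ∀ k → ∃[ j ] InLayer p j k
  layer k = layer-below k k (pivot-lower k)

  layer-first : ∀ j → ∃[ k ] InLayer p j k × k ℕ.< p j
  layer-first zero    = 0 , pivot-lower 0 , pivot-lower 0
  layer-first (suc j) = p j , (ℕₚ.≤-refl , proj₂ proper j) , proj₂ proper j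

  -- Since the witness lies below `k`, it is a valid position in every array that contains `k`; the
  -- cut-off of the last layer at the array's length does no harm.
  layer-before : ∀ k → 0 ℕ.< k → ∃[ j ] ∃[ k′ ] k′ ℕ.< k × InLayer p j k′ × InLayer p (suc j) k
  layer-before k 0<k with layer k
  ... | zero , k<p₀ = contradiction (subst (k ℕ.<_) (proj₁ proper) k<p₀) (ℕₚ.≤⇒≯ 0<k)
  ... | suc j , k∈ = let k′ , k′∈ , k′<pⱼ = layer-first j in
    j , k′ , ℕₚ.<-≤-trans k′<pⱼ (proj₁ k∈) , k′∈ , k∈

module _ {α : ℝ} (proper : ∀ p → IsPivots α p → ProperPivots p) where

  -- Every position after the first has an element of the preceding layer before it, so the least of
  -- distinct values can only come first.
  IsLOH-not-least : ∀ {b : Vector ℕ n} → IsLOH α b → ∀ k → 0 ℕ.< toℕ k →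
    ∃[ k′ ] k′ ≢ k × b k′ ℕ.≤ b k
  IsLOH-not-least {n} (p , pivots , ordered) k 0<k
    with layer-before (proper p pivots) (toℕ k) 0<k
  ... | j , k′ , k′<k , k′∈ , k∈ = fromℕ< k′<n ,
    (λ eq → ℕₚ.<⇒≢ k′<k (trans (sym (Finₚ.toℕ-fromℕ< k′<n)) (cong toℕ eq))) ,
    ordered j _ k (subst (InLayer p j) (sym (Finₚ.toℕ-fromℕ< k′<n)) k′∈) k∈
    where
      k′<n : k′ ℕ.< n
      k′<n = ℕₚ.<-trans k′<k (Finₚ.toℕ<n k)

  -- Position 1 opens layer 1, as `p 0` is 1 and `p 1` exceeds 1. Hence the greatest of distinct
  -- values never comes first.
  IsLOH-not-greatest : ∀ {b : Vector ℕ (suc (suc n))} → IsLOH α b →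
    b Fin.zero ℕ.≤ b (Fin.suc Fin.zero)
  IsLOH-not-greatest (p , pivots , ordered) = ordered 0 Fin.zero (Fin.suc Fin.zero)
    (pivot-lower (proper p pivots) 0)
    (ℕₚ.≤-reflexive (proj₁ (proper p pivots)) , pivot-lower (proper p pivots) 1)

  -- If π puts a i first, replace a i by the new maximum M, else by the new
  -- minimum 0.
  replacement-detected : ∀ (a : Vector ℕ (suc (suc n))) (π : Permutation′ (suc (suc n))) i M →
    (∀ k → 0 ℕ.< a k) → (∀ k → a k ℕ.< M) →
    ¬ (∀ v → (∀ k → a k ≢ v) → IsLOH α (λ k → updateAt a i (const v) (π ⟨$⟩ʳ k)))
  replacement-detected {n} a π i M 0<a a<M loh = cases (π ⟨$⟩ˡ i) refl
    where
      b : ℕ → Vector ℕ (suc (suc n))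
      b v k = updateAt a i (const v) (π ⟨$⟩ʳ k)

      b-i : ∀ {k} v → π ⟨$⟩ˡ i ≡ k → b v k ≡ v
      b-i v refl = trans (cong (updateAt a i (const v)) (inverseʳ π)) (updateAt-updates i a)

      b-other : ∀ {k} v k′ → π ⟨$⟩ˡ i ≡ k → k′ ≢ k → b v k′ ≡ a (π ⟨$⟩ʳ k′)
      b-other v k′ refl k′≢k = updateAt-minimal _ i a
        (λ eq → k′≢k (trans (sym (inverseˡ π)) (cong (π ⟨$⟩ˡ_) eq)))

      cases : ∀ k → π ⟨$⟩ˡ i ≡ k → ⊥
      cases Fin.zero eq = ℕₚ.<⇒≱ (a<M (π ⟨$⟩ʳ Fin.suc Fin.zero))
        (subst₂ ℕ._≤_ (b-i M eq) (b-other M (Fin.suc Fin.zero) eq λ ())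
          (IsLOH-not-greatest {b = b M} (loh M (λ k → ℕₚ.<⇒≢ (a<M k)))))
      cases k@(Fin.suc _) eq =
        let k′ , k′≢k , b≤ = IsLOH-not-least {b = b 0} (loh 0 (λ k → ℕₚ.>⇒≢ (0<a k))) k (s≤s z≤n)
        in ℕₚ.<⇒≱ (0<a (π ⟨$⟩ʳ k′)) (subst₂ ℕ._≤_ (b-other 0 k′ eq k′≢k) (b-i 0 eq) b≤)

  -- If `i` were never compared, replacing its value by any fresh one would leave the permutation as
  -- it is, against `replacement-detected`.
  all-compared : (t : DecisionTree (suc (suc n))) → LOHifies α t →
    ∀ i → i ∈ comparands t (suc ∘ toℕ)
  all-compared {n} t lohifies i with any? (i Finₚ.≟_) (comparands t (suc ∘ toℕ))
  ... | yes i∈ = i∈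
  -- Shifting the identity by one leaves 0 free as a new minimum; the values end at n + 2, so n + 3
  -- is a new maximum.
  ... | no  i∉ = ⊥-elim (replacement-detected a (result t a) i (suc (suc (suc n)))
    (λ _ → s≤s z≤n) (λ k → s≤s (Finₚ.toℕ<n k))
    λ v fresh → subst (λ ρ → IsLOH α (λ k → updateAt a i (const v) (ρ ⟨$⟩ʳ k)))
      (result-unchanged t i∉ (λ k k≢i → updateAt-minimal k i a k≢i))
      (lohifies (updateAt a i (const v))
        (updateAt-distinct (Finₚ.toℕ-injective ∘ ℕₚ.suc-injective) i v fresh)))
    where
      a : Vector ℕ (suc (suc n))
      a = suc ∘ toℕ

  -- Each comparison involves two indices, and between them all `n` indices must occur.
  n≤comparisons*2 : (t : DecisionTree n) → 2 ℕ.≤ n → LOHifies α t →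
    ∃[ a ] Distinct a × n ℕ.≤ comparisons t a ℕ.* 2
  n≤comparisons*2 {suc (suc n)} t (s≤s (s≤s _)) lohifies = suc ∘ toℕ ,
    Finₚ.toℕ-injective ∘ ℕₚ.suc-injective ,
    subst (suc (suc n) ℕ.≤_) (length-comparands t (suc ∘ toℕ))
      (covering-length (comparands t (suc ∘ toℕ)) (all-compared t lohifies))

-- Leaves of a decision tree that sorts

leaf : ∀ w → DecisionTree n → Vector ℕ n → Fin (2 ℕ.^ w)
leaf zero    t                 a = Fin.zero
-- A path shorter than `w` is padded with zeros, so all codes have the same length.
leaf (suc w) (output π)        a = combine {2} Fin.zero (leaf w (output π) a)
leaf (suc w) (compare i j t u) a =
  if does (a i ℕₚ.<? a j) then combine {2} Fin.zero (leaf w t a)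
                          else combine {2} (Fin.suc Fin.zero) (leaf w u a)

-- At most `w` comparisons means that the code is not cut short; a common first bit then leads both
-- inputs into the same subtree.
leaf-determines-result : ∀ w (t : DecisionTree n) {a a′} →
  comparisons t a ℕ.≤ w → comparisons t a′ ℕ.≤ w →
  leaf w t a ≡ leaf w t a′ → result t a ≡ result t a′
leaf-determines-result w (output π) _ _ _ = refl
leaf-determines-result (suc w) (compare i j t u) {a} {a′} (s≤s c≤) (s≤s c′≤) eq
  with does (a i ℕₚ.<? a j) | does (a′ i ℕₚ.<? a′ j)
... | true  | true  = leaf-determines-result w t c≤ c′≤
  (Finₚ.combine-injectiveʳ {2} Fin.zero _ Fin.zero _ eq)
... | false | false = leaf-determines-result w u c≤ c′≤
  (Finₚ.combine-injectiveʳ {2} (Fin.suc Fin.zero) _ (Fin.suc Fin.zero) _ eq)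
... | true  | false = contradiction (Finₚ.combine-injectiveˡ {2} Fin.zero _ (Fin.suc Fin.zero) _ eq) λ ()
... | false | true  = contradiction (Finₚ.combine-injectiveˡ {2} (Fin.suc Fin.zero) _ Fin.zero _ eq) λ ()

Sorted : Vector ℕ n → Set
Sorted b = ∀ {i j} → i Fin.≤ j → b i ℕ.≤ b j

Sorts : DecisionTree n → Set
Sorts t = ∀ a → Distinct a → Sorted (λ k → a (result t a ⟨$⟩ʳ k))

-- `a x < a y` forces `π` to place `x` before `y`, and this placement bounds `a′` as well.
sorted-same-order : ∀ {a a′ : Vector ℕ n} (π : Permutation′ n) →
  Sorted (λ k → a (π ⟨$⟩ʳ k)) → Sorted (λ k → a′ (π ⟨$⟩ʳ k)) →
  ∀ x y → a x ℕ.< a y → a′ x ℕ.≤ a′ y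
sorted-same-order {n} {a} {a′} π sorted sorted′ x y a<a
  with ℕₚ.≤-total (toℕ (π ⟨$⟩ˡ x)) (toℕ (π ⟨$⟩ˡ y))
... | inj₁ x≤y = subst₂ (λ u v → a′ u ℕ.≤ a′ v) (inverseʳ π) (inverseʳ π) (sorted′ x≤y)
... | inj₂ y≤x = contradiction
  (subst₂ (λ u v → a u ℕ.≤ a v) (inverseʳ π) (inverseʳ π) (sorted y≤x)) (ℕₚ.<⇒≱ a<a)

module _ (m r : ℕ) (m≤r : m ℕ.≤ r) where

  -- The gap assigned to an entry: `weave` orders by this key first and by index second.
  key : (Fin m → Fin m) → Fin (m ℕ.+ r) → Fin r
  key g k with splitAt m k
  ... | inj₁ j = Fin.inject≤ (g j) m≤r
  ... | inj₂ i = i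

  -- The first m entries are interleaved with the others: entry j < m lies
  -- below entry m + i exactly if g j ≤ i.
  weave : (Fin m → Fin m) → Vector ℕ (m ℕ.+ r)
  weave g k = toℕ (combine (key g k) k)

  weave-distinct : ∀ g → Distinct (weave g)
  weave-distinct g {k} {l} eq =
    Finₚ.combine-injectiveʳ (key g k) k (key g l) l (Finₚ.toℕ-injective eq)

  -- Both keys are `g j`, and the tie is broken by index, where `j` < `m`.
  weave-below : ∀ g j → weave g (j ↑ˡ r) ℕ.< weave g (m ↑ʳ Fin.inject≤ (g j) m≤r)
  weave-below g j
    rewrite Finₚ.toℕ-combine (key g (j ↑ˡ r)) (j ↑ˡ r)
          | Finₚ.toℕ-combine (key g (m ↑ʳ Fin.inject≤ (g j) m≤r)) (m ↑ʳ Fin.inject≤ (g j) m≤r)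
          | Finₚ.splitAt-↑ˡ m j r | Finₚ.splitAt-↑ʳ m r (Fin.inject≤ (g j) m≤r)
          | Finₚ.toℕ-↑ˡ j r | Finₚ.toℕ-↑ʳ m (Fin.inject≤ (g j) m≤r) =
    ℕₚ.+-monoʳ-< _ (ℕₚ.<-≤-trans (Finₚ.toℕ<n j) (ℕₚ.m≤m+n m _))

  weave-above : ∀ g j i → i Fin.< g j →
    weave g (m ↑ʳ Fin.inject≤ i m≤r) ℕ.< weave g (j ↑ˡ r)
  weave-above g j i i<gj = Finₚ.combine-monoˡ-< (m ↑ʳ Fin.inject≤ i m≤r) (j ↑ˡ r) lt
    where
      lt : key g (m ↑ʳ Fin.inject≤ i m≤r) Fin.< key g (j ↑ˡ r)
      lt rewrite Finₚ.splitAt-↑ˡ m j r | Finₚ.splitAt-↑ʳ m r (Fin.inject≤ i m≤r)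
               | Finₚ.toℕ-inject≤ i m≤r | Finₚ.toℕ-inject≤ (g j) m≤r = i<gj

  module _ (t : DecisionTree (m ℕ.+ r)) (sorts : Sorts t) where

    -- With v = `g j` < `g′ j`, entry `j` lies below entry `m` + v in `weave g` but above it in
    -- `weave g′`; no permutation sorts both.
    equal-result⇒≮ : ∀ g g′ → result t (weave g) ≡ result t (weave g′) →
      ∀ j → ¬ (g j Fin.< g′ j)
    equal-result⇒≮ g g′ eq j g<g′ = ℕₚ.<⇒≱ (weave-above g′ j (g j) g<g′)
      (sorted-same-order {a = weave g} {weave g′} (result t (weave g))
        (sorts _ (weave-distinct g))
        (subst (λ ρ → Sorted (λ k → weave g′ (ρ ⟨$⟩ʳ k))) (sym eq)
          (sorts _ (weave-distinct g′)))
        (j ↑ˡ r) (m ↑ʳ Fin.inject≤ (g j) m≤r) (weave-below g j))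

    result-injective : ∀ g g′ → result t (weave g) ≡ result t (weave g′) →
      ∀ j → g j ≡ g′ j
    result-injective g g′ eq j with Finₚ.<-cmp (g j) (g′ j)
    ... | tri< g<g′ _ _ = contradiction g<g′ (equal-result⇒≮ g g′ eq j)
    ... | tri≈ _ g≡g′ _ = g≡g′
    ... | tri> _ _ g′<g = contradiction g′<g (equal-result⇒≮ g′ g (sym eq) j)

    -- Coded by `finToFun`, the functions from `Fin m` to itself are exactly `m ^ m` many, and
    -- different ones reach different leaves.
    m^m≤2^w : ∀ {w} → (∀ a → Distinct a → comparisons t a ℕ.≤ w) → m ℕ.^ m ℕ.≤ 2 ℕ.^ w
    m^m≤2^w {w} bound = Finₚ.injective⇒≤ {f = λ x → leaf w t (weave (finToFun x))} inj
      where
        inj : Injective _≡_ _≡_ (λ x → leaf w t (weave (finToFun {m} {m} x)))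
        inj {x} {y} eq = trans (sym (Finₚ.funToFin-finToFin {m} {m} x))
          (trans (funToFin-cong (result-injective (finToFun x) (finToFun y)
            (leaf-determines-result w t (bound _ (weave-distinct (finToFun x)))
              (bound _ (weave-distinct (finToFun y))) eq)))
            (Finₚ.funToFin-finToFin {m} {m} y))
          where
            -- Results determine the functions only pointwise, so equality of codes is derived digit
            -- by digit.
            funToFin-cong : ∀ {k l} {f h : Fin k → Fin l} → (∀ i → f i ≡ h i) → funToFin f ≡ funToFin h
            funToFin-cong {zero}  f≗h = refl
            funToFin-cong {suc k} f≗h = cong₂ combine (f≗h Fin.zero) (funToFin-cong (f≗h ∘ Fin.suc))

-- Rational and real bounds

ι : ℕ → ℚ
ι n = ℤ.+ n ℚ./ 1

toℚᵘ-ι : ∀ n → ℚ.toℚᵘ (ι n) ℚᵘ.≃ mkℚᵘ (ℤ.+ n) 0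
toℚᵘ-ι n = ℚₚ.toℚᵘ-fromℚᵘ (mkℚᵘ (ℤ.+ n) 0)

-- Normalised rationals do not compute on variables, so the equation is checked on unnormalised
-- fractions over 1.
ι-+ : ∀ m n → ι (m ℕ.+ n) ≡ ι m ℚ.+ ι n
ι-+ m n = ℚₚ.toℚᵘ-injective (begin
  ℚ.toℚᵘ (ι (m ℕ.+ n))                   ≈⟨ toℚᵘ-ι (m ℕ.+ n) ⟩
  mkℚᵘ (ℤ.+ (m ℕ.+ n)) 0                 ≈⟨ ℚᵘ.*≡* (cong (ℤ._* ℤ.+ 1)
                                               (sym (cong₂ ℤ._+_ (ℤₚ.*-identityʳ (ℤ.+ m)) (ℤₚ.*-identityʳ (ℤ.+ n))))) ⟩
  mkℚᵘ (ℤ.+ m) 0 ℚᵘ.+ mkℚᵘ (ℤ.+ n) 0     ≈⟨ ℚᵘₚ.+-cong (toℚᵘ-ι m) (toℚᵘ-ι n) ⟨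
  ℚ.toℚᵘ (ι m) ℚᵘ.+ ℚ.toℚᵘ (ι n)         ≈⟨ ℚₚ.toℚᵘ-homo-+ (ι m) (ι n) ⟨
  ℚ.toℚᵘ (ι m ℚ.+ ι n)                   ∎)
  where open ℚᵘₚ.≃-Reasoning

ι-* : ∀ m n → ι (m ℕ.* n) ≡ ι m ℚ.* ι n
ι-* m n = ℚₚ.toℚᵘ-injective (begin
  ℚ.toℚᵘ (ι (m ℕ.* n))                   ≈⟨ toℚᵘ-ι (m ℕ.* n) ⟩
  mkℚᵘ (ℤ.+ (m ℕ.* n)) 0                 ≈⟨ ℚᵘ.*≡* (cong (ℤ._* ℤ.+ 1) (ℤₚ.pos-* m n)) ⟩
  mkℚᵘ (ℤ.+ m) 0 ℚᵘ.* mkℚᵘ (ℤ.+ n) 0     ≈⟨ ℚᵘₚ.*-cong (toℚᵘ-ι m) (toℚᵘ-ι n) ⟨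
  ℚ.toℚᵘ (ι m) ℚᵘ.* ℚ.toℚᵘ (ι n)         ≈⟨ ℚₚ.toℚᵘ-homo-* (ι m) (ι n) ⟨
  ℚ.toℚᵘ (ι m ℚ.* ι n)                   ∎)
  where open ℚᵘₚ.≃-Reasoning

ι-*-1/ : ∀ j → ι (suc j) ℚ.* (ℤ.+ 1 ℚ./ suc j) ≡ 1ℚ
ι-*-1/ j = ℚₚ.toℚᵘ-injective (begin
  ℚ.toℚᵘ (ι (suc j) ℚ.* (ℤ.+ 1 ℚ./ suc j))            ≈⟨ ℚₚ.toℚᵘ-homo-* (ι (suc j)) (ℤ.+ 1 ℚ./ suc j) ⟩
  ℚ.toℚᵘ (ι (suc j)) ℚᵘ.* ℚ.toℚᵘ (ℤ.+ 1 ℚ./ suc j)    ≈⟨ ℚᵘₚ.*-cong (toℚᵘ-ι (suc j)) (ℚₚ.toℚᵘ-fromℚᵘ (mkℚᵘ (ℤ.+ 1) j)) ⟩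
  mkℚᵘ (ℤ.+ suc j) 0 ℚᵘ.* mkℚᵘ (ℤ.+ 1) j              ≈⟨ ℚᵘ.*≡* (cong ℤ.+_ arith) ⟩
  ℚᵘ.1ℚᵘ                                              ∎)
  where
    open ℚᵘₚ.≃-Reasoning
    arith : suc j ℕ.* 1 ℕ.* 1 ≡ 1 ℕ.* (1 ℕ.* suc j)
    arith = trans (ℕₚ.*-identityʳ _) (trans (ℕₚ.*-identityʳ _)
      (sym (trans (ℕₚ.*-identityˡ _) (ℕₚ.*-identityˡ _))))

ι-suc : ∀ n → ι n ℚ.+ 1ℚ ≡ ι (suc n)
ι-suc n = trans (ℚₚ.+-comm (ι n) 1ℚ) (sym (ι-+ 1 n))

0≤ι : ∀ n → 0ℚ ℚ.≤ ι n
0≤ι n = ℚₚ.nonNegative⁻¹ (ι n) {{ℚₚ.normalize-nonNeg n 1}}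

0≤1 : 0ℚ ℚ.≤ 1ℚ
0≤1 = 0≤ι 1

ι-mono-≤ : ∀ {m n} → m ℕ.≤ n → ι m ℚ.≤ ι n
ι-mono-≤ {m} {n} m≤n = begin
  ι m                       ≡⟨ ℚₚ.+-identityʳ (ι m) ⟨
  ι m ℚ.+ 0ℚ                ≤⟨ ℚₚ.+-monoʳ-≤ (ι m) (0≤ι (n ℕ.∸ m)) ⟩
  ι m ℚ.+ ι (n ℕ.∸ m)       ≡⟨ ι-+ m (n ℕ.∸ m) ⟨
  ι (m ℕ.+ (n ℕ.∸ m))       ≡⟨ cong ι (ℕₚ.m+[n∸m]≡n m≤n) ⟩
  ι n                       ∎
  where open ℚₚ.≤-Reasoning

-- The denominator is at least 1, so the absolute value of the numerator is a bound.
archimedean : ∀ q → ∃[ b ] q ℚ.≤ ι b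
archimedean q@(mkℚ n d _) = ℤ.∣ n ∣ , ℚₚ.toℚᵘ-cancel-≤ (begin
  ℚ.toℚᵘ q                  ≤⟨ ℚᵘ.*≤* (bound n) ⟩
  mkℚᵘ (ℤ.+ ℤ.∣ n ∣) 0      ≃⟨ toℚᵘ-ι ℤ.∣ n ∣ ⟨
  ℚ.toℚᵘ (ι ℤ.∣ n ∣)        ∎)
  where
    open ℚᵘₚ.≤-Reasoning
    bound : ∀ n → n ℤ.* ℤ.+ 1 ℤ.≤ ℤ.+ ℤ.∣ n ∣ ℤ.* ℤ.+ suc d
    bound (ℤ.+ n) = subst₂ ℤ._≤_ (ℤₚ.pos-* n 1) (ℤₚ.pos-* n (suc d))
      (ℤ.+≤+ (ℕₚ.*-monoʳ-≤ n (s≤s z≤n)))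
    bound ℤ.-[1+ n ] = subst (ℤ._≤_ _) (ℤₚ.pos-* (suc n) (suc d)) ℤ.-≤+

*-monoˡ : ∀ {p q r} → 0ℚ ℚ.≤ r → p ℚ.≤ q → r ℚ.* p ℚ.≤ r ℚ.* q
*-monoˡ {r = r} 0≤r = ℚₚ.*-monoˡ-≤-nonNeg r {{ℚ.nonNegative 0≤r}}

*-monoʳ : ∀ {p q r} → 0ℚ ℚ.≤ r → p ℚ.≤ q → p ℚ.* r ℚ.≤ q ℚ.* r
*-monoʳ {r = r} 0≤r = ℚₚ.*-monoʳ-≤-nonNeg r {{ℚ.nonNegative 0≤r}}

0≤* : ∀ {p q} → 0ℚ ℚ.≤ p → 0ℚ ℚ.≤ q → 0ℚ ℚ.≤ p ℚ.* q
0≤* {p} {q} 0≤p 0≤q = subst (ℚ._≤ p ℚ.* q) (ℚₚ.*-zeroʳ p) (*-monoˡ 0≤p 0≤q)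

<⇒≱ : ∀ {p q} → p ℚ.< q → ¬ (q ℚ.≤ p)
<⇒≱ p<q q≤p = ℚₚ.<-irrefl refl (ℚₚ.<-≤-trans p<q q≤p)

p≤∣p∣ : ∀ p → p ℚ.≤ ∣ p ∣
p≤∣p∣ p with ℚₚ.≤-total 0ℚ p
... | inj₁ 0≤p = ℚₚ.≤-reflexive (sym (ℚₚ.0≤p⇒∣p∣≡p 0≤p))
... | inj₂ p≤0 = ℚₚ.≤-trans p≤0 (ℚₚ.0≤∣p∣ p)

∣-∣<⇒< : ∀ p q {ε} → ∣ p ℚ.- q ∣ ℚ.< ε → p ℚ.< q ℚ.+ ε
∣-∣<⇒< p q {ε} close = begin-strict
  p                      ≡⟨ split p q ⟩
  q ℚ.+ (p ℚ.- q)        ≤⟨ ℚₚ.+-monoʳ-≤ q (p≤∣p∣ (p ℚ.- q)) ⟩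
  q ℚ.+ ∣ p ℚ.- q ∣      <⟨ ℚₚ.+-monoʳ-< q close ⟩
  q ℚ.+ ε                ∎
  where
    open ℚₚ.≤-Reasoning
    split : ∀ p q → p ≡ q ℚ.+ (p ℚ.- q)
    split = solve 2 (λ p q → p := q :+ (p :- q)) refl where open +-*-Solver

∣-∣-sym : ∀ p q → ∣ p ℚ.- q ∣ ≡ ∣ q ℚ.- p ∣
∣-∣-sym p q = trans (cong ∣_∣ (flip p q)) (ℚₚ.∣-p∣≡∣p∣ (q ℚ.- p))
  where
    flip : ∀ p q → p ℚ.- q ≡ ℚ.- (q ℚ.- p)
    flip = solve 2 (λ p q → p :- q := :- (q :- p)) refl where open +-*-Solver

-- Powers and the growth of (1 + y/m) ^ m

0≤^ : ∀ {p} → 0ℚ ℚ.≤ p → ∀ j → 0ℚ ℚ.≤ p ^ℚ j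
0≤^ 0≤p zero    = 0≤1
0≤^ 0≤p (suc j) = 0≤* 0≤p (0≤^ 0≤p j)

^-mono : ∀ {p q} → 0ℚ ℚ.≤ p → p ℚ.≤ q → ∀ j → p ^ℚ j ℚ.≤ q ^ℚ j
^-mono 0≤p p≤q zero    = ℚₚ.≤-refl
^-mono 0≤p p≤q (suc j) = ℚₚ.≤-trans
  (*-monoʳ (0≤^ 0≤p j) p≤q) (*-monoˡ (ℚₚ.≤-trans 0≤p p≤q) (^-mono 0≤p p≤q j))

ι-^ : ∀ m j → ι (m ℕ.^ j) ≡ ι m ^ℚ j
ι-^ m zero    = refl
ι-^ m (suc j) = trans (ι-* m (m ℕ.^ j)) (cong (ι m ℚ.*_) (ι-^ m j))

-- In the induction step (1 + t) (1 + m t) exceeds 1 + (m + 1) t by m t².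
bernoulli : ∀ {t} → 0ℚ ℚ.≤ t → ∀ m → 1ℚ ℚ.+ ι m ℚ.* t ℚ.≤ (1ℚ ℚ.+ t) ^ℚ m
bernoulli {t} 0≤t zero    = ℚₚ.≤-reflexive (trans (cong (1ℚ ℚ.+_) (ℚₚ.*-zeroˡ t)) refl)
bernoulli {t} 0≤t (suc m) = begin
  1ℚ ℚ.+ ι (suc m) ℚ.* t
    ≡⟨ cong (λ s → 1ℚ ℚ.+ s ℚ.* t) (ι-+ 1 m) ⟩
  1ℚ ℚ.+ (1ℚ ℚ.+ ι m) ℚ.* t
    ≡⟨ ℚₚ.+-identityʳ _ ⟨
  1ℚ ℚ.+ (1ℚ ℚ.+ ι m) ℚ.* t ℚ.+ 0ℚ
    ≤⟨ ℚₚ.+-monoʳ-≤ (1ℚ ℚ.+ (1ℚ ℚ.+ ι m) ℚ.* t) (0≤* (0≤* (0≤ι m) 0≤t) 0≤t) ⟩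
  1ℚ ℚ.+ (1ℚ ℚ.+ ι m) ℚ.* t ℚ.+ ι m ℚ.* t ℚ.* t
    ≡⟨ regroup (ι m) t ⟩
  (1ℚ ℚ.+ t) ℚ.* (1ℚ ℚ.+ ι m ℚ.* t)
    ≤⟨ *-monoˡ (ℚₚ.+-mono-≤ 0≤1 0≤t) (bernoulli 0≤t m) ⟩
  (1ℚ ℚ.+ t) ^ℚ suc m ∎
  where
    open ℚₚ.≤-Reasoning
    regroup : ∀ s t → 1ℚ ℚ.+ (1ℚ ℚ.+ s) ℚ.* t ℚ.+ s ℚ.* t ℚ.* t ≡ (1ℚ ℚ.+ t) ℚ.* (1ℚ ℚ.+ s ℚ.* t)
    regroup = solve 2 (λ s t →
      con 1ℚ :+ (con 1ℚ :+ s) :* t :+ s :* t :* t := (con 1ℚ :+ t) :* (con 1ℚ :+ s :* t)) refl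
      where open +-*-Solver

-- The index makes `suc j` equal to `suc ℓ` * `suc M`. Already for y = ℓ + 1 the base is 1 + 1/(M +
-- 1), whose power M + 1 is at least 2 by Bernoulli; raising this to ℓ + 1 gives the bound. As `M`
-- is free, such indices occur arbitrarily late.
compound-lower : ∀ ℓ M {y} → ι (suc ℓ) ℚ.≤ y → let j = M ℕ.+ ℓ ℕ.* suc M in
  ι (2 ℕ.^ suc ℓ) ℚ.≤ (1ℚ ℚ.+ y ℚ.* (ℤ.+ 1 ℚ./ suc j)) ^ℚ suc j
compound-lower ℓ M {y} ℓ≤y = begin
  ι (2 ℕ.^ suc ℓ)                        ≡⟨ ι-^ 2 (suc ℓ) ⟩
  ι 2 ^ℚ suc ℓ                           ≡⟨ cong (λ s → (1ℚ ℚ.+ s) ^ℚ suc ℓ) mt≡1 ⟨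
  (1ℚ ℚ.+ ι (suc M) ℚ.* t) ^ℚ suc ℓ      ≤⟨ ^-mono (ℚₚ.+-mono-≤ 0≤1 (0≤* (0≤ι (suc M)) 0≤t)) (bernoulli 0≤t (suc M)) (suc ℓ) ⟩
  ((1ℚ ℚ.+ t) ^ℚ suc M) ^ℚ suc ℓ         ≡⟨ ^ℚ-assocʳ (1ℚ ℚ.+ t) (suc M) (suc ℓ) ⟩
  (1ℚ ℚ.+ t) ^ℚ (suc M ℕ.* suc ℓ)        ≡⟨ cong ((1ℚ ℚ.+ t) ^ℚ_) (ℕₚ.*-comm (suc M) (suc ℓ)) ⟩
  (1ℚ ℚ.+ t) ^ℚ suc j                    ≤⟨ ^-mono (ℚₚ.+-mono-≤ 0≤1 0≤t) (ℚₚ.+-monoʳ-≤ 1ℚ (*-monoʳ 0≤δ ℓ≤y)) (suc j) ⟩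
  (1ℚ ℚ.+ y ℚ.* δ) ^ℚ suc j              ∎
  where
    open ℚₚ.≤-Reasoning
    j : ℕ
    j = M ℕ.+ ℓ ℕ.* suc M
    δ t : ℚ
    δ = ℤ.+ 1 ℚ./ suc j
    t = ι (suc ℓ) ℚ.* δ
    0≤δ : 0ℚ ℚ.≤ δ
    0≤δ = ℚₚ.nonNegative⁻¹ δ {{ℚₚ.normalize-nonNeg 1 (suc j)}}
    0≤t : 0ℚ ℚ.≤ t
    0≤t = 0≤* (0≤ι (suc ℓ)) 0≤δ
    mt≡1 : ι (suc M) ℚ.* t ≡ 1ℚ
    mt≡1 = trans (sym (ℚₚ.*-assoc (ι (suc M)) (ι (suc ℓ)) δ))
      (trans (cong (ℚ._* δ) (trans (sym (ι-* (suc M) (suc ℓ))) (cong ι (ℕₚ.*-comm (suc M) (suc ℓ)))))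
        (ι-*-1/ j))

-- Eventual upper bounds on real numbers

Eventually : (ℕ → Set) → Set
Eventually P = ∃[ N ] ∀ k → N ℕ.≤ k → P k

always : ∀ {P : ℕ → Set} → (∀ k → P k) → Eventually P
always p = 0 , λ k _ → p k

map : ∀ {P Q : ℕ → Set} → (∀ {k} → P k → Q k) → Eventually P → Eventually Q
map f (N , p) = N , λ k N≤k → f (p k N≤k)

zip : ∀ {P Q R : ℕ → Set} → (∀ {k} → P k → Q k → R k) →
      Eventually P → Eventually Q → Eventually R
zip f (M , p) (N , q) = M ℕ.⊔ N , λ k k≥ →
  f (p k (ℕₚ.m⊔n≤o⇒m≤o M N k≥)) (q k (ℕₚ.m⊔n≤o⇒n≤o M N k≥))

sometime : ∀ {P : ℕ → Set} → Eventually P → ∃[ k ] P k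
sometime (N , p) = N , p N ℕₚ.≤-refl

-- Used to refute `_<_`, and so to prove `_≤_`: two eventual properties hold together at some index.
not-both : ∀ {P Q : ℕ → Set} → (∀ {k} → P k → ¬ Q k) → Eventually P → ¬ Eventually Q
not-both f p q = proj₂ (sometime (zip f p q))

p≱p+ε : ∀ p {ε} → 0ℚ ℚ.< ε → ¬ (p ℚ.+ ε ℚ.≤ p)
p≱p+ε p {ε} 0<ε p+ε≤p = <⇒≱ (subst (ℚ._< p ℚ.+ ε) (ℚₚ.+-identityʳ p) (ℚₚ.+-monoʳ-< p 0<ε)) p+ε≤p

infix 4 _≲_
-- A record rather than a definition, so that x and b can be inferred from a proof.
record _≲_ (x : ℝ) (b : ℕ) : Set where
  constructor ≲-intro
  field
    eventually-≤ : Eventually (λ k → seq x k ℚ.≤ ι b)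

Nonneg : ℝ → Set
Nonneg x = Eventually (λ k → 0ℚ ℚ.≤ seq x k)

≲-weaken : ∀ {x b c} → b ℕ.≤ c → x ≲ b → x ≲ c
≲-weaken b≤c (≲-intro x≲b) = ≲-intro (map (λ x≤b → ℚₚ.≤-trans x≤b (ι-mono-≤ b≤c)) x≲b)

-- Equal reals have entries that are only eventually close, so the bound is raised by one.
≲-≈ : ∀ {x y b} → x ≈ y → y ≲ b → x ≲ suc b
≲-≈ {x} {y} {b} x≈y (≲-intro y≲b) = ≲-intro (zip
  (λ {k} close y≤b → ℚₚ.<⇒≤ (ℚₚ.<-≤-trans (∣-∣<⇒< (seq x k) (seq y k) close)
    (subst (seq y k ℚ.+ 1ℚ ℚ.≤_) (ι-suc b)
      (ℚₚ.+-monoˡ-≤ 1ℚ y≤b))))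
  (x≈y 1ℚ (ℚₚ.positive⁻¹ 1ℚ)) y≲b)

≲-+ : ∀ {x y b c} → x ≲ b → y ≲ c → x + y ≲ b ℕ.+ c
≲-+ {b = b} {c} (≲-intro x≲b) (≲-intro y≲c) = ≲-intro (zip
  (λ x≤b y≤c → subst (_ ℚ.≤_) (sym (ι-+ b c)) (ℚₚ.+-mono-≤ x≤b y≤c)) x≲b y≲c)

-- The chain is x y ≤ x c ≤ b c, which lets `y` be a logarithm of unknown sign.
≲-*ˡ : ∀ {x y b c} → Nonneg x → x ≲ b → y ≲ c → x * y ≲ b ℕ.* c
≲-*ˡ {b = b} {c} 0≤x (≲-intro x≲b) (≲-intro y≲c) = ≲-intro (zip
  (λ (0≤x , x≤b) y≤c → subst (_ ℚ.≤_) (sym (ι-* b c))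
    (ℚₚ.≤-trans (*-monoˡ 0≤x y≤c) (*-monoʳ (0≤ι c) x≤b)))
  (zip _,_ 0≤x x≲b) y≲c)

≲-*ʳ : ∀ {x y b c} → Nonneg y → x ≲ b → y ≲ c → x * y ≲ b ℕ.* c
≲-*ʳ {b = b} {c} 0≤y (≲-intro x≲b) (≲-intro y≲c) = ≲-intro (zip
  (λ x≤b (0≤y , y≤c) → subst (_ ℚ.≤_) (sym (ι-* b c))
    (ℚₚ.≤-trans (*-monoʳ 0≤y x≤b) (*-monoˡ (0≤ι b) y≤c)))
  x≲b (zip _,_ 0≤y y≲c))

≲-fromℕ : ∀ n → fromℕ n ≲ n
≲-fromℕ n = ≲-intro (always λ _ → ℚₚ.≤-refl)

Nonneg-fromℕ : ∀ n → Nonneg (fromℕ n)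
Nonneg-fromℕ n = always λ _ → 0≤ι n

Nonneg-* : ∀ {x y} → Nonneg x → Nonneg y → Nonneg (x * y)
Nonneg-* = zip 0≤*

≲-bounded : ∀ x → ∃[ b ] x ≲ b
≲-bounded x = let q , 0<q , x≤q = bounded x
                  b , q≤b = archimedean q
  in b , ≲-intro (map (λ {k} ∣x∣≤q → ℚₚ.≤-trans (p≤∣p∣ (seq x k)) (ℚₚ.≤-trans ∣x∣≤q q≤b)) x≤q)

0≤recip : ∀ {q} → 0ℚ ℚ.< q → 0ℚ ℚ.≤ recip q
0≤recip {q} 0<q with ℚₚ.≤-total 0ℚ (recip q)
... | inj₁ 0≤r = 0≤r
... | inj₂ r≤0 = contradiction
  (subst₂ ℚ._≤_ (recip-inverse 0<q) (ℚₚ.*-zeroʳ q) (*-monoˡ (ℚₚ.<⇒≤ 0<q) r≤0))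
  (<⇒≱ (ℚₚ.positive⁻¹ 1ℚ))

*-recip-≤ : ∀ {p q r} → 0ℚ ℚ.< q → p ℚ.≤ r ℚ.* q → p ℚ.* recip q ℚ.≤ r
*-recip-≤ {p} {q} {r} 0<q p≤rq = begin
  p ℚ.* recip q              ≤⟨ *-monoʳ (0≤recip 0<q) p≤rq ⟩
  (r ℚ.* q) ℚ.* recip q      ≡⟨ ℚₚ.*-assoc r q (recip q) ⟩
  r ℚ.* (q ℚ.* recip q)      ≡⟨ cong (r ℚ.*_) (recip-inverse 0<q) ⟩
  r ℚ.* 1ℚ                   ≡⟨ ℚₚ.*-identityʳ r ⟩
  r                          ∎
  where open ℚₚ.≤-Reasoning

seq-^ : ∀ x j k → seq (x ^ j) k ≡ seq x k ^ℚ j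
seq-^ x zero    k = refl
seq-^ x (suc j) k = cong (seq x k ℚ.*_) (seq-^ x j k)

-- The order of reals is undecidable, so one late rational entry is compared with m + 1. Later
-- entries differ from it by less than 1: they stay below m + 2 in one case and above m in the
-- other.
≲-unless : ∀ y m → ¬ Eventually (λ k → ι m ℚ.≤ seq y k) → y ≲ suc (suc m)
≲-unless y m ¬large = let N , yN = cauchy y 1ℚ (ℚₚ.positive⁻¹ 1ℚ) in cases N yN (seq y N ℚₚ.≤? ι (suc m))
  where
    cases : ∀ N → (∀ j k → N ℕ.≤ j → N ℕ.≤ k → ∣ seq y j ℚ.- seq y k ∣ ℚ.< 1ℚ) →
            Dec (seq y N ℚ.≤ ι (suc m)) → y ≲ suc (suc m)
    cases N yN (yes yN≤) = ≲-intro (N , λ k k≥ → ℚₚ.<⇒≤ (ℚₚ.<-≤-trans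
      (∣-∣<⇒< (seq y k) (seq y N) (yN k N k≥ ℕₚ.≤-refl))
      (subst (seq y N ℚ.+ 1ℚ ℚ.≤_) (ι-suc (suc m)) (ℚₚ.+-monoˡ-≤ 1ℚ yN≤))))
    cases N yN (no yN≰) = contradiction
      (N , λ k k≥ → ℚₚ.≮⇒≥ λ yk<m → yN≰ (ℚₚ.<⇒≤ (ℚₚ.<-trans
        (∣-∣<⇒< (seq y N) (seq y k) (yN N k ℕₚ.≤-refl k≥))
        (subst (seq y k ℚ.+ 1ℚ ℚ.<_) (ι-suc m) (ℚₚ.+-monoˡ-< 1ℚ yk<m)))))
      ¬large

compound-large : ∀ y ℓ M k → ι (suc ℓ) ℚ.≤ seq y k → let j = M ℕ.+ ℓ ℕ.* suc M in
  ι (2 ℕ.^ suc ℓ) ℚ.≤ seq ((1ℝ + y * fromℚ (ℤ.+ 1 ℚ./ suc j)) ^ suc j) k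
compound-large y ℓ M k ℓ≤y = subst (ι (2 ℕ.^ suc ℓ) ℚ.≤_)
  (sym (seq-^ (1ℝ + y * fromℚ (ℤ.+ 1 ℚ./ suc (M ℕ.+ ℓ ℕ.* suc M))) (suc (M ℕ.+ ℓ ℕ.* suc M)) k))
  (compound-lower ℓ M {seq y k} ℓ≤y)

squeeze : ∀ {p q ε b c} → 0ℚ ℚ.< ε → q ℚ.≤ ι b → suc b ℕ.≤ c → ι c ℚ.≤ p → ¬ (p ℚ.+ ε ℚ.≤ q ℚ.+ 1ℚ)
squeeze {p} {q} {ε = ε} {b} {c} 0<ε q≤b b<c c≤p p≤q = p≱p+ε p 0<ε (begin
  p ℚ.+ ε             ≤⟨ p≤q ⟩
  q ℚ.+ 1ℚ            ≤⟨ ℚₚ.+-monoˡ-≤ 1ℚ q≤b ⟩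
  ι b ℚ.+ 1ℚ          ≡⟨ ι-suc b ⟩
  ι (suc b)           ≤⟨ ι-mono-≤ b<c ⟩
  ι c                 ≤⟨ c≤p ⟩
  p                   ∎)
  where open ℚₚ.≤-Reasoning

-- Were y eventually at least ℓ + 1, the powers (1 + y/m) ^ m would reach 2 ^ (ℓ + 1) ≥ b + 1 at
-- arbitrarily late indices m, while they tend to x ≤ b.
IsLn-≲ : ∀ {x y} ℓ {b} → IsLn x y → x ≲ b → suc b ℕ.≤ 2 ℕ.^ suc ℓ → y ≲ suc (suc (suc ℓ))
IsLn-≲ {x} {y} ℓ {b} ln (≲-intro x≲b) b<2^ℓ = ≲-unless y (suc ℓ) λ large →
  -- An error below 1 suffices, because `b` and the power of two are a full unit apart.
  let M , close = ln 1ℚ (ℚₚ.positive⁻¹ 1ℚ) in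
  absurd M large (proj₁ (close (M ℕ.+ ℓ ℕ.* suc M) (ℕₚ.m≤m+n M _)))
  where
    u : ℕ → ℝ
    u M = (1ℝ + y * fromℚ (ℤ.+ 1 ℚ./ suc (M ℕ.+ ℓ ℕ.* suc M))) ^ suc (M ℕ.+ ℓ ℕ.* suc M)

    absurd : ∀ M → Eventually (λ k → ι (suc ℓ) ℚ.≤ seq y k) → ¬ (u M < x + fromℚ 1ℚ)
    absurd M large (ε , 0<ε , below) = not-both
      {λ k → (ι (suc ℓ) ℚ.≤ seq y k) × (seq x k ℚ.≤ ι b)}
      {λ k → seq (u M) k ℚ.+ ε ℚ.≤ seq x k ℚ.+ 1ℚ}
      (λ {k} (ℓ≤y , x≤b) →
        squeeze {seq (u M) k} {seq x k} 0<ε x≤b b<2^ℓ (compound-large y ℓ M k ℓ≤y))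
      (zip _,_ large x≲b) below

-- Reduces `_∈Ω_` to inequalities between natural numbers; the constant is 1/(C + 1).
∈Ω-intro : ∀ {T f} C N →
  (∀ n → N ℕ.≤ n → ∃[ b ] f n ≲ b × b ℕ.≤ suc C ℕ.* T n) → T ∈Ω f
∈Ω-intro {T} {f} C N bound =
  fromℚ c , (c , 0<c , 0 , λ _ _ → ℚₚ.≤-reflexive (ℚₚ.+-identityˡ c)) , N , below
  where
    c : ℚ
    c = ℤ.+ 1 ℚ./ suc C
    0<c : 0ℚ ℚ.< c
    0<c = ℚₚ.positive⁻¹ c {{ℚₚ.normalize-pos 1 (suc C)}}
    below : ∀ n → N ℕ.≤ n → fromℚ c * f n ≤ fromℕ (T n)
    below n n≥ (ε , 0<ε , above) = let b , ≲-intro f≲b , b≤CT = bound n n≥ in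
      not-both (λ {k} f≤b T<cf → p≱p+ε (ι (T n)) 0<ε (begin
        ι (T n) ℚ.+ ε                     ≤⟨ T<cf ⟩
        c ℚ.* seq (f n) k                 ≤⟨ *-monoˡ (ℚₚ.<⇒≤ 0<c) (ℚₚ.≤-trans f≤b (ι-mono-≤ b≤CT)) ⟩
        c ℚ.* ι (suc C ℕ.* T n)           ≡⟨ cong (c ℚ.*_) (ι-* (suc C) (T n)) ⟩
        c ℚ.* (ι (suc C) ℚ.* ι (T n))     ≡⟨ ℚₚ.*-assoc c (ι (suc C)) (ι (T n)) ⟨
        c ℚ.* ι (suc C) ℚ.* ι (T n)       ≡⟨ cong (ℚ._* ι (T n)) (trans (ℚₚ.*-comm c (ι (suc C))) (ι-*-1/ C)) ⟩
        1ℚ ℚ.* ι (T n)                    ≡⟨ ℚₚ.*-identityˡ (ι (T n)) ⟩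
        ι (T n)                           ∎)) f≲b above
      where open ℚₚ.≤-Reasoning

-- The two cases

≈-refl : ∀ {x} → x ≈ x
≈-refl {x} ε 0<ε = 0 , λ k _ → subst (ℚ._< ε) (sym (cong ∣_∣ (ℚₚ.+-inverseʳ (seq x k)))) 0<ε

0<½* : ∀ {ε} → 0ℚ ℚ.< ε → 0ℚ ℚ.< ½ ℚ.* ε
0<½* {ε} 0<ε = subst (ℚ._< ½ ℚ.* ε) (ℚₚ.*-zeroʳ ½) (ℚₚ.*-monoʳ-<-pos ½ 0<ε)

½*+½* : ∀ ε → ½ ℚ.* ε ℚ.+ ½ ℚ.* ε ≡ ε
½*+½* ε = trans (sym (ℚₚ.*-distribʳ-+ ε ½ ½)) (ℚₚ.*-identityˡ ε)

∣-∣-+ : ∀ a b c d {δ η ε} → ∣ a ℚ.- c ∣ ℚ.< δ → ∣ b ℚ.- d ∣ ℚ.< η → δ ℚ.+ η ≡ ε →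
  ∣ (a ℚ.+ b) ℚ.- (c ℚ.+ d) ∣ ℚ.< ε
∣-∣-+ a b c d {δ} {η} {ε} a~c b~d δ+η≡ε = begin-strict
  ∣ (a ℚ.+ b) ℚ.- (c ℚ.+ d) ∣         ≡⟨ cong ∣_∣ (regroup a b c d) ⟩
  ∣ (a ℚ.- c) ℚ.+ (b ℚ.- d) ∣         ≤⟨ ℚₚ.∣p+q∣≤∣p∣+∣q∣ (a ℚ.- c) (b ℚ.- d) ⟩
  ∣ a ℚ.- c ∣ ℚ.+ ∣ b ℚ.- d ∣         <⟨ ℚₚ.+-mono-< a~c b~d ⟩
  δ ℚ.+ η                             ≡⟨ δ+η≡ε ⟩
  ε                                   ∎
  where
    open ℚₚ.≤-Reasoning
    regroup : ∀ a b c d → (a ℚ.+ b) ℚ.- (c ℚ.+ d) ≡ (a ℚ.- c) ℚ.+ (b ℚ.- d)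
    regroup = solve 4 (λ a b c d → (a :+ b) :- (c :+ d) := (a :- c) :+ (b :- d)) refl
      where open +-*-Solver

+-cong : ∀ {x y z w} → x ≈ z → y ≈ w → x + y ≈ z + w
+-cong {x} {y} {z} {w} x≈z y≈w ε 0<ε = zip
  (λ {k} a b → ∣-∣-+ (seq x k) (seq y k) (seq z k) (seq w k) a b (½*+½* ε))
  (x≈z (½ ℚ.* ε) (0<½* 0<ε)) (y≈w (½ ℚ.* ε) (0<½* 0<ε))

≈1-*-close : ∀ x y b {δ η ε} → ∣ x ∣ ℚ.≤ ι (suc b) → ∣ x ℚ.- 1ℚ ∣ ℚ.< η → ∣ y ℚ.- 1ℚ ∣ ℚ.< δ →
  ι (suc b) ℚ.* δ ≡ η → η ℚ.+ η ≡ ε → ∣ x ℚ.* y ℚ.- 1ℚ ∣ ℚ.< ε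
≈1-*-close x y b {δ} {η} {ε} x≤b x~1 y~1 bδ≡η η+η≡ε = begin-strict
  ∣ x ℚ.* y ℚ.- 1ℚ ∣                             ≡⟨ cong ∣_∣ (regroup x y) ⟩
  ∣ x ℚ.* (y ℚ.- 1ℚ) ℚ.+ (x ℚ.- 1ℚ) ∣            ≤⟨ ℚₚ.∣p+q∣≤∣p∣+∣q∣ (x ℚ.* (y ℚ.- 1ℚ)) (x ℚ.- 1ℚ) ⟩
  ∣ x ℚ.* (y ℚ.- 1ℚ) ∣ ℚ.+ ∣ x ℚ.- 1ℚ ∣          ≡⟨ cong (ℚ._+ ∣ x ℚ.- 1ℚ ∣) (ℚₚ.∣p*q∣≡∣p∣*∣q∣ x (y ℚ.- 1ℚ)) ⟩
  ∣ x ∣ ℚ.* ∣ y ℚ.- 1ℚ ∣ ℚ.+ ∣ x ℚ.- 1ℚ ∣        <⟨ ℚₚ.+-mono-≤-<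
                                                     (ℚₚ.≤-trans (*-monoʳ (ℚₚ.0≤∣p∣ (y ℚ.- 1ℚ)) x≤b)
                                                                 (*-monoˡ (0≤ι (suc b)) (ℚₚ.<⇒≤ y~1))) x~1 ⟩
  ι (suc b) ℚ.* δ ℚ.+ η                          ≡⟨ cong (ℚ._+ η) bδ≡η ⟩
  η ℚ.+ η                                        ≡⟨ η+η≡ε ⟩
  ε                                              ∎
  where
    open ℚₚ.≤-Reasoning
    regroup : ∀ x y → x ℚ.* y ℚ.- 1ℚ ≡ x ℚ.* (y ℚ.- 1ℚ) ℚ.+ (x ℚ.- 1ℚ)
    regroup = solve 2 (λ x y → x :* y :- con 1ℚ := x :* (y :- con 1ℚ) :+ (x :- con 1ℚ)) refl
      where open +-*-Solver

≈1-* : ∀ {x y} → x ≈ 1ℝ → y ≈ 1ℝ → x * y ≈ 1ℝ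
≈1-* {x} {y} x≈1 y≈1 ε 0<ε =
  let q , _ , x≤q = bounded x
      b , q≤b = archimedean q
      η = ½ ℚ.* ε
      -- The successor keeps the divisor positive even when `b` is 0.
      1/b = ℤ.+ 1 ℚ./ suc b
      0<η = 0<½* 0<ε
      0<1/b = ℚₚ.positive⁻¹ 1/b {{ℚₚ.normalize-pos 1 (suc b)}}
      0<δ = subst (ℚ._< 1/b ℚ.* η) (ℚₚ.*-zeroʳ 1/b) (ℚₚ.*-monoʳ-<-pos 1/b {{ℚ.positive 0<1/b}} 0<η)
      bδ≡η = trans (sym (ℚₚ.*-assoc (ι (suc b)) 1/b η))
               (trans (cong (ℚ._* η) (ι-*-1/ b)) (ℚₚ.*-identityˡ η))
  in zip (λ {k} (x≤q , x~1) y~1 → ≈1-*-close (seq x k) (seq y k) b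
            (ℚₚ.≤-trans x≤q (ℚₚ.≤-trans q≤b (ι-mono-≤ (ℕₚ.n≤1+n b)))) x~1 y~1 bδ≡η (½*+½* ε))
       (zip _,_ x≤q (x≈1 η 0<η)) (y≈1 (1/b ℚ.* η) 0<δ)

≈1-^ : ∀ {x} → x ≈ 1ℝ → ∀ j → x ^ j ≈ 1ℝ
≈1-^ x≈1 zero    = ≈-refl {1ℝ}
≈1-^ {x} x≈1 (suc j) = ≈1-* {x} {x ^ j} x≈1 (≈1-^ {x} x≈1 j)

≈-resp-seq : ∀ {x y z} → (∀ k → seq y k ≡ seq z k) → x ≈ y → x ≈ z
≈-resp-seq {x} y≡z x≈y ε 0<ε =
  map (λ {k} → subst (λ q → ∣ seq x k ℚ.- q ∣ ℚ.< ε) (y≡z k)) (x≈y ε 0<ε)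

≈1-sum : ∀ {x} → x ≈ 1ℝ → ∀ i → sum (x ^_) i ≈ fromℕ (suc i)
≈1-sum x≈1 zero = ≈-refl {1ℝ}
≈1-sum {x} x≈1 (suc i) =
  ≈-resp-seq {sum (x ^_) (suc i)} {fromℕ (suc i) + 1ℝ} {fromℕ (suc (suc i))} (λ _ → ι-suc (suc i))
    (+-cong {sum (x ^_) i} {x ^ suc i} {fromℕ (suc i)} {1ℝ} (≈1-sum {x} x≈1 i) (≈1-^ {x} x≈1 (suc i)))

0<½ : 0ℚ ℚ.< ½
0<½ = ℚₚ.positive⁻¹ ½

-- If p < m, then x eventually exceeds p by ½, against x ≤ p. If p > m, then p ≥ m + 1 leaves no gap
-- below x + 1.
ceiling-≈-fromℕ : ∀ {x m p} → x ≈ fromℕ m → IsCeiling x p → p ≡ m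
ceiling-≈-fromℕ {x} {m} {p} x≈m (x≤p , ε , 0<ε , p<x+1) with ℕₚ.<-cmp p m
... | tri≈ _ p≡m _ = p≡m
... | tri< p<m _ _ = contradiction
  (½ , 0<½ , map (λ {k} close → ℚₚ.<⇒≤ (p+½<x (seq x k) close)) (x≈m ½ 0<½)) x≤p
  where
    p+½<x : ∀ q → ∣ q ℚ.- ι m ∣ ℚ.< ½ → ι p ℚ.+ ½ ℚ.< q
    p+½<x q close = ℚₚ.≰⇒> λ q≤ → <⇒≱
      (∣-∣<⇒< (ι m) q (subst (ℚ._< ½) (∣-∣-sym q (ι m)) close)) (begin
        q ℚ.+ ½              ≤⟨ ℚₚ.+-monoˡ-≤ ½ q≤ ⟩
        ι p ℚ.+ ½ ℚ.+ ½      ≡⟨ ℚₚ.+-assoc (ι p) ½ ½ ⟩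
        ι p ℚ.+ 1ℚ           ≡⟨ ι-suc p ⟩
        ι (suc p)            ≤⟨ ι-mono-≤ p<m ⟩
        ι m                  ∎)
      where open ℚₚ.≤-Reasoning
-- The gap `ε` in p < x + 1 itself serves as the tolerance for `x ≈ fromℕ m`.
... | tri> _ _ m<p = contradiction p<x+1 (not-both (λ {k} close → p+ε≰x+1 (seq x k) close) (x≈m ε 0<ε))
  where
    p+ε≰x+1 : ∀ q → ∣ q ℚ.- ι m ∣ ℚ.< ε → ¬ (ι p ℚ.+ ε ℚ.≤ q ℚ.+ 1ℚ)
    p+ε≰x+1 q close p≤q = <⇒≱ (ℚₚ.+-monoˡ-< 1ℚ (∣-∣<⇒< q (ι m) close)) (begin
      ι m ℚ.+ ε ℚ.+ 1ℚ       ≡⟨ swap (ι m) ε ⟩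
      ι m ℚ.+ 1ℚ ℚ.+ ε       ≡⟨ cong (ℚ._+ ε) (ι-suc m) ⟩
      ι (suc m) ℚ.+ ε        ≤⟨ ℚₚ.+-monoˡ-≤ ε (ι-mono-≤ m<p) ⟩
      ι p ℚ.+ ε              ≤⟨ p≤q ⟩
      q ℚ.+ 1ℚ               ∎)
      where
        open ℚₚ.≤-Reasoning
        swap : ∀ a b → a ℚ.+ b ℚ.+ 1ℚ ≡ a ℚ.+ 1ℚ ℚ.+ b
        swap = solve 2 (λ a b → a :+ b :+ con 1ℚ := a :+ con 1ℚ :+ b) refl
          where open +-*-Solver

1≤^ : ∀ {p} → 1ℚ ℚ.≤ p → ∀ j → 1ℚ ℚ.≤ p ^ℚ j
1≤^ 1≤p zero    = ℚₚ.≤-refl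
1≤^ {p} 1≤p (suc j) = ℚₚ.≤-trans 1≤p (subst (ℚ._≤ p ^ℚ suc j) (ℚₚ.*-identityʳ p)
  (*-monoˡ (ℚₚ.≤-trans 0≤1 1≤p) (1≤^ 1≤p j)))

-- The sums S grow by α ^ (i + 1) ≥ 1. If p (i + 1) ≤ p i, then p (i + 1) < S i + 1 ≤ S (i + 1),
-- while a ceiling of S (i + 1) is at least S (i + 1).
pivots-proper : ∀ {α} → 1ℝ < α → ∀ p → IsPivots α p → ProperPivots p
pivots-proper {α} (δ , 0<δ , α≥1+δ) p pivots =
  ceiling-≈-fromℕ {1ℝ} {1} {p 0} (≈-refl {1ℝ}) (pivots 0) , λ i → ℕₚ.≰⇒> (increasing i)
  where
    open ℚₚ.≤-Reasoning
    α≥1 : Eventually (λ k → 1ℚ ℚ.≤ seq α k)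
    α≥1 = map (ℚₚ.≤-trans (ℚₚ.≤-trans (ℚₚ.≤-reflexive (sym (ℚₚ.+-identityʳ 1ℚ)))
                                      (ℚₚ.+-monoʳ-≤ 1ℚ (ℚₚ.<⇒≤ 0<δ)))) α≥1+δ
    step : ∀ i {q ε a} → p (suc i) ℕ.≤ p i → 1ℚ ℚ.≤ a → ι (p i) ℚ.+ ε ℚ.≤ q ℚ.+ 1ℚ →
           ι (p (suc i)) ℚ.+ ε ℚ.≤ q ℚ.+ a
    step i {q} {ε} {a} p≤ 1≤a bound = begin
      ι (p (suc i)) ℚ.+ ε      ≤⟨ ℚₚ.+-monoˡ-≤ ε (ι-mono-≤ p≤) ⟩
      ι (p i) ℚ.+ ε            ≤⟨ bound ⟩
      q ℚ.+ 1ℚ                 ≤⟨ ℚₚ.+-monoʳ-≤ q 1≤a ⟩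
      q ℚ.+ a                  ∎
    increasing : ∀ i → ¬ (p (suc i) ℕ.≤ p i)
    increasing i p≤ = let ε , 0<ε , bound = proj₂ (pivots i) in proj₁ (pivots (suc i))
      (ε , 0<ε , zip
        (λ {k} 1≤α → step i {seq (sum (α ^_) i) k} p≤ (subst (1ℚ ℚ.≤_) (sym (seq-^ α (suc i) k)) (1≤^ 1≤α (suc i))))
        α≥1 bound)

adjacent⇒sorted : ∀ {n} {b : Vector ℕ n} →
  (∀ k k′ → toℕ k′ ≡ suc (toℕ k) → b k ℕ.≤ b k′) → Sorted b
adjacent⇒sorted adj {Fin.zero} {Fin.zero} _ = ℕₚ.≤-refl
adjacent⇒sorted {suc (suc n)} adj {Fin.zero} {Fin.suc j} _ =
  ℕₚ.≤-trans (adj Fin.zero (Fin.suc Fin.zero) refl)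
    (adjacent⇒sorted (λ k k′ eq → adj (Fin.suc k) (Fin.suc k′) (cong suc eq)) {Fin.zero} {j} z≤n)
adjacent⇒sorted {suc n} adj {Fin.suc i} {Fin.suc j} (s≤s i≤j) =
  adjacent⇒sorted (λ k k′ eq → adj (Fin.suc k) (Fin.suc k′) (cong suc eq)) i≤j

-- Here p i = i + 1, so position i alone forms layer i and the heap condition relates neighbouring
-- positions.
IsLOH-≈1-sorted : ∀ {α n} {b : Vector ℕ n} → α ≈ 1ℝ → IsLOH α b → Sorted b
IsLOH-≈1-sorted {α} α≈1 (p , pivots , ordered) = adjacent⇒sorted λ k k′ k′≡1+k →
  ordered (toℕ k) k k′ (singleton (toℕ k))
    (subst (λ l → InLayer p l (toℕ k′)) k′≡1+k (singleton (toℕ k′)))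
  where
    p≡suc : ∀ i → p i ≡ suc i
    p≡suc i = ceiling-≈-fromℕ {sum (α ^_) i} {suc i} {p i} (≈1-sum {α} α≈1 i) (pivots i)
    singleton : ∀ i → InLayer p i i
    singleton zero    = subst (0 ℕ.<_) (sym (p≡suc 0)) (s≤s z≤n)
    singleton (suc i) = ℕₚ.≤-reflexive (p≡suc i) , ℕₚ.≤-reflexive (sym (p≡suc (suc i)))

LOHifies-≈1-sorts : ∀ {α n} → α ≈ 1ℝ → (t : DecisionTree n) → LOHifies α t → Sorts t
LOHifies-≈1-sorts {α} α≈1 t lohifies a distinct = IsLOH-≈1-sorted {α} α≈1 (lohifies a distinct)

-- Binary logarithms and the sorting bound

n<2^n : ∀ n → n ℕ.< 2 ℕ.^ n
n<2^n zero    = s≤s z≤n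
n<2^n (suc n) = ℕₚ.≤-trans (ℕₚ.+-mono-≤ (ℕₚ.m^n>0 2 n) (n<2^n n))
  (ℕₚ.+-monoʳ-≤ (2 ℕ.^ n) (ℕₚ.m≤m+n (2 ℕ.^ n) 0))

log₂-bracket : ∀ m → ∃[ e ] 2 ℕ.^ e ℕ.≤ suc m × suc m ℕ.< 2 ℕ.^ suc e
log₂-bracket zero = 0 , s≤s z≤n , s≤s (s≤s z≤n)
log₂-bracket (suc m) =
  let e , lower , upper = log₂-bracket m in cases e lower upper (suc (suc m) ℕₚ.<? 2 ℕ.^ suc e)
  where
    cases : ∀ e → 2 ℕ.^ e ℕ.≤ suc m → suc m ℕ.< 2 ℕ.^ suc e → Dec (suc (suc m) ℕ.< 2 ℕ.^ suc e) →
            ∃[ e′ ] 2 ℕ.^ e′ ℕ.≤ suc (suc m) × suc (suc m) ℕ.< 2 ℕ.^ suc e′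
    cases e lower upper (yes m<) = e , ℕₚ.m≤n⇒m≤1+n lower , m<
    cases e lower upper (no  m≮) = suc e , ℕₚ.≮⇒≥ m≮ ,
      ℕₚ.<-≤-trans (ℕₚ.m<m*n (suc (suc m)) 2 (s≤s (s≤s z≤n)))
        (ℕₚ.≤-trans (ℕₚ.≤-reflexive (ℕₚ.*-comm (suc (suc m)) 2)) (ℕₚ.*-monoʳ-≤ 2 upper))

2^-cancel-≤ : ∀ {a b} → 2 ℕ.^ a ℕ.≤ 2 ℕ.^ b → a ℕ.≤ b
2^-cancel-≤ {a} {b} le = ℕₚ.≮⇒≥ λ b<a → ℕₚ.<⇒≱ (ℕₚ.^-monoʳ-< 2 (s≤s (s≤s z≤n)) b<a) le

sorting-lower-bound : ∀ n (t : DecisionTree n) → Sorts t → ∀ {w} →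
  (∀ a → Distinct a → comparisons t a ℕ.≤ w) → ⌊ n /2⌋ ℕ.^ ⌊ n /2⌋ ℕ.≤ 2 ℕ.^ w
sorting-lower-bound n = split n (ℕₚ.⌊n/2⌋≤⌈n/2⌉ n) (sym (ℕₚ.⌊n/2⌋+⌈n/2⌉≡n n))
  where
    -- The length is generalised so that matching on the equation turns `t` into a tree on m + r
    -- entries.
    split : ∀ n {m r} → m ℕ.≤ r → n ≡ m ℕ.+ r → (t : DecisionTree n) → Sorts t → ∀ {w} →
      (∀ a → Distinct a → comparisons t a ℕ.≤ w) → m ℕ.^ m ℕ.≤ 2 ℕ.^ w
    split _ {m} {r} m≤r refl t sorts = m^m≤2^w m r m≤r t sorts

-- Upper estimates of the claimed bound

÷-≲ : ∀ {x y a b} y>0 → Eventually (λ k → 0ℚ ℚ.< seq y k) → x ≲ a →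
  Eventually (λ k → ι a ℚ.≤ ι b ℚ.* seq y k) → x ÷ y ⟨ y>0 ⟩ ≲ b
÷-≲ {b = b} y>0 0<y (≲-intro x≲a) a≤by = ≲-intro (zip (λ 0<y (x≤a , a≤by) → *-recip-≤ {r = ι b} 0<y (ℚₚ.≤-trans x≤a a≤by))
  0<y (zip _,_ x≲a a≤by))

-- The denominator is eventually at least ½, so the quotient is at most 2 n < 2 ^ (ℓ + 1) and its
-- logarithm at most ℓ + 3. The two extra units come from the passages along `_≈_`.
≈1-bound : ∀ {α} (α≈1 : α ≈ 1ℝ) n v ℓ → suc (2 ℕ.* n) ℕ.≤ 2 ℕ.^ suc ℓ → IsBound α (inj₁ α≈1) n v →
  v ≲ suc (n ℕ.* (3 ℕ.+ ℓ) ℕ.+ suc n)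
≈1-bound {α} α≈1 n v ℓ n<2^ℓ (l , s , ln , s≈n , v≈) =
  ≲-≈ {v} {fromℕ n * l + s} v≈ (≲-+ {fromℕ n * l} {s}
    (≲-*ˡ {fromℕ n} {l} (Nonneg-fromℕ n) (≲-fromℕ n)
      (IsLn-≲ {fromℕ n ÷ denominator α n ⟨ >0 ⟩} {l} ℓ ln quotient n<2^ℓ))
    (≲-≈ {s} {fromℕ n} s≈n (≲-fromℕ n)))
  where
    >0 : 0ℝ < denominator α n
    >0 = denominator>0 {α} (inj₁ α≈1) n
    -- The witness of denominator>0 is ½ here.
    ½≤den : Eventually (λ k → 0ℚ ℚ.+ ½ ℚ.≤ seq (denominator α n) k)
    ½≤den = proj₂ (proj₂ >0)
    n≤2n*q : ∀ {q} → 0ℚ ℚ.+ ½ ℚ.≤ q → ι n ℚ.≤ ι (2 ℕ.* n) ℚ.* q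
    n≤2n*q {q} ½≤q = begin
      ι n                            ≡⟨ ℚₚ.*-identityˡ (ι n) ⟨
      (ι 2 ℚ.* ½) ℚ.* ι n            ≡⟨ swap (ι 2) ½ (ι n) ⟩
      (ι 2 ℚ.* ι n) ℚ.* ½            ≡⟨ cong (ℚ._* ½) (ι-* 2 n) ⟨
      ι (2 ℕ.* n) ℚ.* ½              ≤⟨ *-monoˡ (0≤ι (2 ℕ.* n)) ½≤q ⟩
      ι (2 ℕ.* n) ℚ.* q              ∎
      where
        open ℚₚ.≤-Reasoning
        swap : ∀ a b c → (a ℚ.* b) ℚ.* c ≡ (a ℚ.* c) ℚ.* b
        swap = solve 3 (λ a b c → (a :* b) :* c := (a :* c) :* b) refl where open +-*-Solver
    quotient : fromℕ n ÷ denominator α n ⟨ >0 ⟩ ≲ 2 ℕ.* n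
    quotient = ÷-≲ {fromℕ n} {denominator α n} >0
      (map (ℚₚ.<-≤-trans 0<½) ½≤den) (≲-fromℕ n) (map n≤2n*q ½≤den)

-- With α ≥ 1 + ε, `E` ≥ 1/ε and `B` ≥ α eventually, the quotient is at most `E`, and b < 2 ^ b
-- bounds the two logarithms by `E` + 3 and `B` + 3. Both terms are then at most a multiple of n.
>1-bound : ∀ {α} (α>1 : 1ℝ < α) → ∃[ K ] ∀ n → 1 ℕ.≤ n → ∀ v → IsBound α (inj₂ α>1) n v → v ≲ n ℕ.* K
>1-bound {α} α>1@(ε , 0<ε , 1+ε≤α) =
  -- The final 2 pays for the two units lost along `_≈_`, since n ≥ 1.
  (3 ℕ.+ E) ℕ.+ B ℕ.* (3 ℕ.+ B) ℕ.* E ℕ.+ 2 , λ n 1≤n v bound → ≲-weaken {v} (total n 1≤n) (estimate n v bound)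
  where
    open ℚₚ.≤-Reasoning

    E : ℕ
    E = proj₁ (archimedean (recip ε))

    1≤Eε : 1ℚ ℚ.≤ ι E ℚ.* ε
    1≤Eε = begin
      1ℚ                 ≡⟨ recip-inverse 0<ε ⟨
      ε ℚ.* recip ε      ≤⟨ *-monoˡ (ℚₚ.<⇒≤ 0<ε) (proj₂ (archimedean (recip ε))) ⟩
      ε ℚ.* ι E          ≡⟨ ℚₚ.*-comm ε (ι E) ⟩
      ι E ℚ.* ε          ∎

    B : ℕ
    B = proj₁ (≲-bounded α)

    α≲B : α ≲ B
    α≲B = proj₂ (≲-bounded α)

    ε≤α-1 : Eventually (λ k → ε ℚ.≤ seq (α - 1ℝ) k)
    ε≤α-1 = map (subst (ℚ._≤ _) (ℚₚ.+-identityˡ ε)) (proj₂ (proj₂ (α-1>0 {α} α>1)))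

    0≤α : Nonneg α
    0≤α = map (ℚₚ.≤-trans (ℚₚ.+-mono-≤ 0≤1 (ℚₚ.<⇒≤ 0<ε))) 1+ε≤α

    1≤Ed : ∀ {d} → ε ℚ.≤ d → 1ℚ ℚ.≤ ι E ℚ.* d
    1≤Ed ε≤d = ℚₚ.≤-trans 1≤Eε (*-monoˡ (0≤ι E) ε≤d)

    inv-≲ : inv (α - 1ℝ) (α-1>0 {α} α>1) ≲ E
    inv-≲ = ≲-intro (map (λ {k} ε≤d → subst (ℚ._≤ ι E) (ℚₚ.*-identityˡ (recip (seq (α - 1ℝ) k)))
      (*-recip-≤ (ℚₚ.<-≤-trans 0<ε ε≤d) (1≤Ed ε≤d))) ε≤α-1)

    inv-nonneg : Nonneg (inv (α - 1ℝ) (α-1>0 {α} α>1))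
    inv-nonneg = map (λ ε≤d → 0≤recip (ℚₚ.<-≤-trans 0<ε ε≤d)) ε≤α-1

    module _ (n : ℕ) where

      0<den : ∀ {d} → ε ℚ.≤ d → 0ℚ ℚ.< ι n ℚ.* d ℚ.+ 1ℚ
      0<den {d} ε≤d = ℚₚ.+-mono-≤-< (0≤* (0≤ι n) (ℚₚ.≤-trans (ℚₚ.<⇒≤ 0<ε) ε≤d)) (ℚₚ.positive⁻¹ 1ℚ)

      n≤E*den : ∀ {d} → ε ℚ.≤ d → ι n ℚ.≤ ι E ℚ.* (ι n ℚ.* d ℚ.+ 1ℚ)
      n≤E*den {d} ε≤d = begin
        ι n                               ≡⟨ ℚₚ.*-identityʳ (ι n) ⟨
        ι n ℚ.* 1ℚ                        ≤⟨ *-monoˡ (0≤ι n) (1≤Ed ε≤d) ⟩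
        ι n ℚ.* (ι E ℚ.* d)               ≡⟨ ℚₚ.+-identityʳ (ι n ℚ.* (ι E ℚ.* d)) ⟨
        ι n ℚ.* (ι E ℚ.* d) ℚ.+ 0ℚ        ≤⟨ ℚₚ.+-monoʳ-≤ (ι n ℚ.* (ι E ℚ.* d)) (0≤ι E) ⟩
        ι n ℚ.* (ι E ℚ.* d) ℚ.+ ι E       ≡⟨ regroup (ι n) (ι E) d ⟩
        ι E ℚ.* (ι n ℚ.* d ℚ.+ 1ℚ)        ∎
        where
          regroup : ∀ a b c → a ℚ.* (b ℚ.* c) ℚ.+ b ≡ b ℚ.* (a ℚ.* c ℚ.+ 1ℚ)
          regroup = solve 3 (λ a b c → a :* (b :* c) :+ b := b :* (a :* c :+ con 1ℚ)) refl
            where open +-*-Solver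

      quotient : ∀ >0 → fromℕ n ÷ denominator α n ⟨ >0 ⟩ ≲ E
      quotient >0 = ÷-≲ {fromℕ n} {denominator α n} >0
        (map 0<den ε≤α-1) (≲-fromℕ n) (map n≤E*den ε≤α-1)

      second : ∀ s → IsSecondTerm α (inj₂ α>1) n s → s ≲ suc (n ℕ.* B ℕ.* (3 ℕ.+ B) ℕ.* E)
      second s (l , ln , s≈) = ≲-≈ {s} {(fromℕ n * α * l) ÷ (α - 1ℝ) ⟨ α-1>0 {α} α>1 ⟩} s≈
        (≲-*ʳ {fromℕ n * α * l} {inv (α - 1ℝ) (α-1>0 {α} α>1)} inv-nonneg
          (≲-*ˡ {fromℕ n * α} {l} (Nonneg-* {fromℕ n} {α} (Nonneg-fromℕ n) 0≤α)
            (≲-*ˡ {fromℕ n} {α} (Nonneg-fromℕ n) (≲-fromℕ n) α≲B)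
            (IsLn-≲ {α} {l} B ln α≲B (ℕₚ.<⇒≤ (n<2^n (suc B)))))
          inv-≲)

      estimate : ∀ v → IsBound α (inj₂ α>1) n v →
        v ≲ suc (n ℕ.* (3 ℕ.+ E) ℕ.+ suc (n ℕ.* B ℕ.* (3 ℕ.+ B) ℕ.* E))
      estimate v (l , s , ln , isSecond , v≈) = ≲-≈ {v} {fromℕ n * l + s} v≈
        (≲-+ {fromℕ n * l} {s}
          (≲-*ˡ {fromℕ n} {l} (Nonneg-fromℕ n) (≲-fromℕ n)
            (IsLn-≲ {fromℕ n ÷ denominator α n ⟨ denominator>0 {α} (inj₂ α>1) n ⟩} {l} E ln
              (quotient (denominator>0 {α} (inj₂ α>1) n)) (ℕₚ.<⇒≤ (n<2^n (suc E)))))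
          (second s isSecond))

      total : 1 ℕ.≤ n → suc (n ℕ.* (3 ℕ.+ E) ℕ.+ suc (n ℕ.* B ℕ.* (3 ℕ.+ B) ℕ.* E)) ℕ.≤
        n ℕ.* ((3 ℕ.+ E) ℕ.+ B ℕ.* (3 ℕ.+ B) ℕ.* E ℕ.+ 2)
      total 1≤n = ℕₚ.≤-trans
        (ℕₚ.≤-reflexive (lhs n (3 ℕ.+ E) B (3 ℕ.+ B) E))
        (ℕₚ.≤-trans (ℕₚ.+-monoʳ-≤ (n ℕ.* (3 ℕ.+ E) ℕ.+ n ℕ.* (B ℕ.* (3 ℕ.+ B) ℕ.* E)) (ℕₚ.*-monoˡ-≤ 2 1≤n))
          (ℕₚ.≤-reflexive (rhs n (3 ℕ.+ E) (B ℕ.* (3 ℕ.+ B) ℕ.* E))))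
        where
          lhs : ∀ n a b c d → suc (n ℕ.* a ℕ.+ suc (n ℕ.* b ℕ.* c ℕ.* d)) ≡
                              n ℕ.* a ℕ.+ n ℕ.* (b ℕ.* c ℕ.* d) ℕ.+ 1 ℕ.* 2
          lhs = solve 5 (λ n a b c d → con 1 :+ (n :* a :+ (con 1 :+ n :* b :* c :* d)) :=
            n :* a :+ n :* (b :* c :* d) :+ con 1 :* con 2) refl
            where open ℕ-Solver
          rhs : ∀ n a b → n ℕ.* a ℕ.+ n ℕ.* b ℕ.+ n ℕ.* 2 ≡ n ℕ.* (a ℕ.+ b ℕ.+ 2)
          rhs = solve 3 (λ n a b → n :* a :+ n :* b :+ n :* con 2 := n :* (a :+ b :+ con 2)) refl
            where open ℕ-Solver

-- Matching the estimates with the runtime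

n≤3⌊n/2⌋ : ∀ n → 2 ℕ.≤ n → n ℕ.≤ 3 ℕ.* ⌊ n /2⌋
n≤3⌊n/2⌋ n 2≤n = begin
  n                                    ≡⟨ ℕₚ.⌊n/2⌋+⌈n/2⌉≡n n ⟨
  -- `⌈ n /2⌉` unfolds to `⌊ suc n /2⌋`, which is at most `⌊ suc (suc n) /2⌋`, that is 1 + m.
  m ℕ.+ ⌈ n /2⌉                        ≤⟨ ℕₚ.+-monoʳ-≤ m (ℕₚ.⌊n/2⌋-mono (ℕₚ.n≤1+n (suc n))) ⟩
  m ℕ.+ (1 ℕ.+ m)                      ≤⟨ ℕₚ.+-monoʳ-≤ m (ℕₚ.+-monoˡ-≤ m (ℕₚ.⌊n/2⌋-mono 2≤n)) ⟩
  m ℕ.+ (m ℕ.+ m)                      ≡⟨ cong (λ k → m ℕ.+ (m ℕ.+ k)) (ℕₚ.+-identityʳ m) ⟨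
  3 ℕ.* m                              ∎
  where
    open ℕₚ.≤-Reasoning
    m : ℕ
    m = ⌊ n /2⌋

2n<4[1+⌊n/2⌋] : ∀ n → suc (2 ℕ.* n) ℕ.≤ 4 ℕ.* suc ⌊ n /2⌋
2n<4[1+⌊n/2⌋] n = begin
  suc (2 ℕ.* n)                        ≡⟨ cong (λ k → suc (2 ℕ.* k)) (ℕₚ.⌊n/2⌋+⌈n/2⌉≡n n) ⟨
  suc (2 ℕ.* (m ℕ.+ ⌈ n /2⌉))          ≤⟨ s≤s (ℕₚ.*-monoʳ-≤ 2 (ℕₚ.+-monoʳ-≤ m (ℕₚ.⌊n/2⌋-mono (ℕₚ.n≤1+n (suc n))))) ⟩
  suc (2 ℕ.* (m ℕ.+ suc m))            ≤⟨ ℕₚ.n≤1+n _ ⟩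
  suc (suc (2 ℕ.* (m ℕ.+ suc m)))      ≡⟨ solve 1 (λ m → con 2 :+ con 2 :* (m :+ (con 1 :+ m)) := con 4 :* (con 1 :+ m)) refl m ⟩
  4 ℕ.* suc m                          ∎
  where
    open ℕₚ.≤-Reasoning
    open ℕ-Solver
    m : ℕ
    m = ⌊ n /2⌋

-- The left side is the estimate of `≈1-bound` at ℓ = 2 + e. The factor 24 is 3 times 8, from n ≤ 3
-- `⌊ n /2⌋` and 7 + e ≤ 8 e.
≈1-arithmetic : ∀ n e {w} → 2 ℕ.≤ n → 1 ℕ.≤ e → e ℕ.* ⌊ n /2⌋ ℕ.≤ w →
  suc (n ℕ.* (5 ℕ.+ e) ℕ.+ suc n) ℕ.≤ 24 ℕ.* w
≈1-arithmetic n e {w} 2≤n 1≤e em≤w = begin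
  suc (n ℕ.* (5 ℕ.+ e) ℕ.+ suc n)      ≡⟨ solve 2 (λ n e → con 1 :+ (n :* (con 5 :+ e) :+ (con 1 :+ n)) := con 2 :+ n :* (con 6 :+ e)) refl n e ⟩
  2 ℕ.+ n ℕ.* (6 ℕ.+ e)                ≤⟨ ℕₚ.+-monoˡ-≤ (n ℕ.* (6 ℕ.+ e)) 2≤n ⟩
  n ℕ.+ n ℕ.* (6 ℕ.+ e)                ≡⟨ ℕₚ.*-suc n (6 ℕ.+ e) ⟨
  n ℕ.* (7 ℕ.+ e)                      ≤⟨ ℕₚ.*-mono-≤ (n≤3⌊n/2⌋ n 2≤n) (ℕₚ.+-monoˡ-≤ e (ℕₚ.*-monoʳ-≤ 7 1≤e)) ⟩
  3 ℕ.* m ℕ.* (7 ℕ.* e ℕ.+ e)          ≡⟨ solve 2 (λ m e → con 3 :* m :* (con 7 :* e :+ e) := con 24 :* (e :* m)) refl m e ⟩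
  24 ℕ.* (e ℕ.* m)                     ≤⟨ ℕₚ.*-monoʳ-≤ 24 em≤w ⟩
  24 ℕ.* w                             ∎
  where
    open ℕₚ.≤-Reasoning
    open ℕ-Solver
    m : ℕ
    m = ⌊ n /2⌋

-- For m = `⌊ n /2⌋`, the exponent e is the integer part of log₂ m. From 2 ^ (e m) ≤ m ^ m ≤ 2 ^ w
-- follows e m ≤ w, and 2 n + 1 ≤ 4 (m + 1) ≤ 2 ^ (3 + e). Since n ≥ 4, m ≥ 2 and so e ≥ 1.
sorting-runtime : ∀ n (t : DecisionTree n) → Sorts t → ∀ {w} →
  (∀ a → Distinct a → comparisons t a ℕ.≤ w) → 4 ℕ.≤ n →
  ∃[ e ] 1 ℕ.≤ e × suc (2 ℕ.* n) ℕ.≤ 2 ℕ.^ (3 ℕ.+ e) × e ℕ.* ⌊ n /2⌋ ℕ.≤ w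
sorting-runtime n t sorts {w} bound 4≤n =
  let e , lower , upper = log₂-bracket (ℕ.pred m)
  in e , 1≤e e (subst (ℕ._< 2 ℕ.^ suc e) 1+[m-1]≡m upper) ,
     ℕₚ.≤-trans (2n<4[1+⌊n/2⌋] n) (ℕₚ.≤-trans (ℕₚ.*-monoʳ-≤ 4 (subst (ℕ._< 2 ℕ.^ suc e) 1+[m-1]≡m upper))
       (ℕₚ.≤-reflexive (ℕₚ.*-assoc 2 2 (2 ℕ.^ suc e)))) ,
     2^-cancel-≤ (ℕₚ.≤-trans (ℕₚ.≤-reflexive (sym (ℕₚ.^-*-assoc 2 e m)))
       (ℕₚ.≤-trans (ℕₚ.^-monoˡ-≤ m (subst (2 ℕ.^ e ℕ.≤_) 1+[m-1]≡m lower))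
         (sorting-lower-bound n t sorts bound)))
  where
    m : ℕ
    m = ⌊ n /2⌋
    2≤m : 2 ℕ.≤ m
    2≤m = ℕₚ.⌊n/2⌋-mono 4≤n
    1+[m-1]≡m : suc (ℕ.pred m) ≡ m
    1+[m-1]≡m = ℕₚ.suc-pred m {{ℕ.>-nonZero (ℕₚ.<⇒≤ 2≤m)}}
    1≤e : ∀ e → m ℕ.< 2 ℕ.^ suc e → 1 ℕ.≤ e
    1≤e zero    m<2 = contradiction 2≤m (ℕₚ.<⇒≱ m<2)
    1≤e (suc e) _   = s≤s z≤n

theorem2p2 : (α : ℝ) (α≥1 : α ≥1)
    (f : ℕ → ℝ) → (∀ n → 1 ℕ.≤ n → IsBound α α≥1 n (f n)) →
    (A : ∀ n → DecisionTree n) → (∀ n → LOHifies α (A n)) →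
    (T : ℕ → ℕ) → (∀ n → IsWorstCase (A n) (T n)) →
    T ∈Ω f
theorem2p2 α (inj₁ α≈1) f isBound A lohifies T worst = ∈Ω-intro {T} {f} 23 4 λ n 4≤n →
  let e , 1≤e , n<2^ , em≤T = sorting-runtime n (A n)
        (LOHifies-≈1-sorts {α} α≈1 (A n) (lohifies n)) (proj₁ (worst n)) 4≤n
      2≤n = ℕₚ.≤-trans (s≤s (s≤s z≤n)) 4≤n
  in suc (n ℕ.* (5 ℕ.+ e) ℕ.+ suc n) ,
     ≈1-bound {α} α≈1 n (f n) (2 ℕ.+ e) n<2^ (isBound n (ℕₚ.<⇒≤ 2≤n)) ,
     ≈1-arithmetic n e 2≤n 1≤e em≤T
theorem2p2 α (inj₂ α>1) f isBound A lohifies T worst =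
  let K , linear = >1-bound {α} α>1 in
  -- From n ≤ 2 T n follows n K ≤ 2 K T n; the factor has to be a successor, so one more multiple of
  -- T n is conceded.
  ∈Ω-intro {T} {f} (2 ℕ.* K) 2 λ n 2≤n →
    let a , distinct , n≤ = n≤comparisons*2 {α} (pivots-proper {α} α>1) (A n) 2≤n (lohifies n)
    in n ℕ.* K , linear n (ℕₚ.<⇒≤ 2≤n) (f n) (isBound n (ℕₚ.<⇒≤ 2≤n)) ,
       arithmetic n K (T n) (ℕₚ.≤-trans n≤ (ℕₚ.*-monoˡ-≤ 2 (proj₁ (worst n) a distinct)))
  where
    open ℕₚ.≤-Reasoning
    arithmetic : ∀ n K w → n ℕ.≤ w ℕ.* 2 → n ℕ.* K ℕ.≤ suc (2 ℕ.* K) ℕ.* w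
    arithmetic n K w n≤ = begin
      n ℕ.* K                       ≤⟨ ℕₚ.*-monoˡ-≤ K n≤ ⟩
      w ℕ.* 2 ℕ.* K                 ≤⟨ ℕₚ.m≤n+m (w ℕ.* 2 ℕ.* K) w ⟩
      w ℕ.+ w ℕ.* 2 ℕ.* K           ≡⟨ solve 2 (λ w K → w :+ w :* con 2 :* K := (con 1 :+ con 2 :* K) :* w) refl w K ⟩
      suc (2 ℕ.* K) ℕ.* w           ∎
      where open ℕ-Solver
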